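{- Let $h\geq 3$ and let $G$ be a VPT graph. Then $G$ is a minimal non $[h,2,1]$ graph if and only if there exists an $(h+1)$-critical graph $H$ such that $G\simeq G_H$.
   Context: All graphs are finite, simple and connected. A VPT representation of $G$ is a tree $T$ with paths $(P_v)_{v\in V(G)}$ of $T$ such that $uv\in E(G)$ iff $P_u,P_v$ share a vertex; $G$ is VPT if it has one. $[h,2,1]$ is the class of graphs admitting a VPT representation whose host tree has maximum degree at most $h$. A minimal non $[h,2,1]$ graph is a graph $G\notin[h,2,1]$ with $G-v\in[h,2,1]$ for all $v\in V(G)$. A graph with chromatic number $k$ is $k$-critical if deleting any vertex or any edge lowers the chromatic number. Given a graph $H$ with $V(H)=\{v_1,\dots,v_n\}$, $G_H$ is the graph with vertex set: $v_i$ for $1\le i\le n$; $v_{ij}$ for $1\le i<j\le n$ with $v_iv_j\in E(H)$; $\tilde v_i$ for each $i$ with $d_H(v_i)=1$. Edges: all vertices $v_{ij}$ and $\tilde v_i$ are pairwise adjacent; $v_1,\dots,v_n$ are pairwise non-adjacent; $v_i$ is adjacent exactly to the vertices $v_{ij}$/$v_{ji}$ corresponding to edges of $H$ at $v_i$, and to $\tilde v_i$ if $d_H(v_i)=1$. -}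

module Defs where

open import Data.Nat using (ℕ; zero; suc; _≤_; _<_)
open import Data.Bool using (Bool; true; false; T; _∧_; _∨_; not)
open import Data.Bool.Properties using (∧-comm; ∨-comm)
open import Data.Fin as Fin using (Fin; punchIn)
open import Data.Fin.Properties using (_≟_)
open import Data.List using (List; []; _∷_; length; filterᵇ; allFin; _∷ʳ_)
open import Data.List.Membership.Propositional using (_∈_)
open import Data.List.Relation.Unary.Linked using (Linked)
open import Data.List.Relation.Unary.Unique.Propositional using (Unique)
open import Data.Product using (Σ; _×_; _,_)
open import Data.Sum using (_⊎_)
open import Data.Empty using (⊥)
open import Data.Unit using (⊤)
open import Relation.Nullary using (¬_)
open import Relation.Nullary.Decidable using (⌊_⌋)
open import Relation.Binary.PropositionalEquality using (_≡_; _≢_; refl; cong₂; trans)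
open import Function.Bundles using (_⇔_; _↔_; Inverse)

record Graph : Set where
  field
    n      : ℕ
    adj    : Fin n → Fin n → Bool
    sym    : ∀ i j → adj i j ≡ adj j i
    irrefl : ∀ i → adj i i ≡ false

open Graph public

E : (G : Graph) → Fin (n G) → Fin (n G) → Set
E G x y = T (adj G x y)

degree : (G : Graph) → Fin (n G) → ℕ
degree G x = length (filterᵇ (adj G x) (allFin (n G)))

MaxDegreeAtMost : ℕ → Graph → Set
MaxDegreeAtMost h G = ∀ x → degree G x ≤ h

data Reach (G : Graph) : Fin (n G) → Fin (n G) → Set where
  here : ∀ {x} → Reach G x x
  step : ∀ {x y z} → E G x y → Reach G y z → Reach G x z

Connected : Graph → Set
Connected G = ∀ x y → Reach G x y

IsPath : (G : Graph) → List (Fin (n G)) → Set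
IsPath G xs = ¬ (xs ≡ []) × Unique xs × Linked (E G) xs

IsCycle : (G : Graph) → List (Fin (n G)) → Set
IsCycle G [] = ⊥
IsCycle G (x ∷ ys) = 2 ≤ length ys × Unique (x ∷ ys) × Linked (E G) ((x ∷ ys) ∷ʳ x)

Acyclic : Graph → Set
Acyclic G = ∀ xs → ¬ IsCycle G xs

IsTree : Graph → Set
IsTree G = Connected G × Acyclic G

record VPTRep (G : Graph) : Set where
  field
    host      : Graph
    hostTree  : IsTree host
    path      : Fin (n G) → List (Fin (n host))
    pathIsPath : ∀ v → IsPath host (path v)
    correct   : ∀ u v → u ≢ v →
                (E G u v ⇔ Σ (Fin (n host)) (λ x → x ∈ path u × x ∈ path v))

open VPTRep public

VPT : Graph → Set
VPT G = VPTRep G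

In[_,2,1] : ℕ → Graph → Set
In[ h ,2,1] G = Σ (VPTRep G) (λ R → MaxDegreeAtMost h (host R))

private
  del : (m : ℕ) (a : Fin m → Fin m → Bool) →
        (∀ i j → a i j ≡ a j i) → (∀ i → a i i ≡ false) → Fin m → Graph
  del (suc m) a s ir i = record
    { n = m
    ; adj = λ x y → a (punchIn i x) (punchIn i y)
    ; sym = λ x y → s (punchIn i x) (punchIn i y)
    ; irrefl = λ x → ir (punchIn i x)
    }

deleteVertex : (G : Graph) → Fin (n G) → Graph
deleteVertex G v = del (n G) (adj G) (sym G) (irrefl G) v

private
  isE : ∀ {m} → Fin m → Fin m → Fin m → Fin m → Bool
  isE u v x y = (⌊ x ≟ u ⌋ ∧ ⌊ y ≟ v ⌋) ∨ (⌊ x ≟ v ⌋ ∧ ⌊ y ≟ u ⌋)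

  isE-sym : ∀ {m} (u v x y : Fin m) → isE u v x y ≡ isE u v y x
  isE-sym u v x y =
    trans (cong₂ _∨_ (∧-comm ⌊ x ≟ u ⌋ ⌊ y ≟ v ⌋) (∧-comm ⌊ x ≟ v ⌋ ⌊ y ≟ u ⌋))
          (∨-comm (⌊ y ≟ v ⌋ ∧ ⌊ x ≟ u ⌋) (⌊ y ≟ u ⌋ ∧ ⌊ x ≟ v ⌋))

  false∧ : ∀ {b c} → b ≡ false → (b ∧ c) ≡ false
  false∧ refl = refl

deleteEdge : (G : Graph) → Fin (n G) → Fin (n G) → Graph
deleteEdge G u v = record
  { n = n G
  ; adj = λ x y → adj G x y ∧ not (isE u v x y)
  ; sym = λ x y → cong₂ (λ a b → a ∧ not b) (sym G x y) (isE-sym u v x y)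
  ; irrefl = λ x → false∧ (irrefl G x)
  }

Colorable : Graph → ℕ → Set
Colorable G k = Σ (Fin (n G) → Fin k) (λ c → ∀ x y → E G x y → c x ≢ c y)

HasChromaticNumber : Graph → ℕ → Set
HasChromaticNumber G k = Colorable G k × (∀ j → j < k → ¬ Colorable G j)

ChromaticNumberBelow : Graph → ℕ → Set
ChromaticNumberBelow G k = Σ ℕ (λ j → j < k × HasChromaticNumber G j)

Critical : ℕ → Graph → Set
Critical k G =
  HasChromaticNumber G k ×
  (∀ v → ChromaticNumberBelow (deleteVertex G v) k) ×
  (∀ u v → E G u v → ChromaticNumberBelow (deleteEdge G u v) k)

MinimalNon[_,2,1] : ℕ → Graph → Set
MinimalNon[ h ,2,1] G =
  ¬ In[ h ,2,1] G × (∀ v → In[ h ,2,1] (deleteVertex G v))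

data GHVertex (H : Graph) : Set where
  vtx   : Fin (n H) → GHVertex H
  evtx  : (i j : Fin (n H)) → i Fin.< j → E H i j → GHVertex H
  lvtx  : (i : Fin (n H)) → degree H i ≡ 1 → GHVertex H

GHAdj : (H : Graph) → GHVertex H → GHVertex H → Set
GHAdj H (vtx i) (vtx j) = ⊥
GHAdj H (vtx i) (evtx j k _ _) = i ≡ j ⊎ i ≡ k
GHAdj H (evtx j k _ _) (vtx i) = i ≡ j ⊎ i ≡ k
GHAdj H (vtx i) (lvtx j _) = i ≡ j
GHAdj H (lvtx j _) (vtx i) = i ≡ j
GHAdj H (evtx i j _ _) (evtx k l _ _) = ¬ (i ≡ k × j ≡ l)
GHAdj H (evtx _ _ _ _) (lvtx _ _) = ⊤
GHAdj H (lvtx _ _) (evtx _ _ _ _) = ⊤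
GHAdj H (lvtx i _) (lvtx j _) = i ≢ j

IsoToGH : Graph → Graph → Set
IsoToGH G H =
  Σ (Fin (n G) ↔ GHVertex H)
    (λ f → ∀ x y → E G x y ⇔ GHAdj H (Inverse.to f x) (Inverse.to f y))

{-# OPTIONS --safe #-}

-- Root the host tree. For a host vertex q, link the neighbours y and z of q whenever some
-- path runs through y, q, z. If every link graph is h-colourable, each q can be replaced by a
-- caterpillar along which its neighbours are spread by colour, which yields a host of maximum
-- degree at most h. Contracting edges y q with nested sets of paths first, every neighbour y
-- lying on a path through q lies on a path avoiding q. So if some link graph is not
-- h-colourable, an (h+1)-critical subgraph H of it gives an induced G_H: v_y is a path through
-- y avoiding q, and v_yz is a path through y, q, z. Conversely G_H is not in [h,2,1]: the paths
-- of the v_ij have a common vertex by the Helly property, and its branches colour H. Deleting a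
-- vertex of G_H corresponds to deleting a vertex or an edge of H, and a colouring of the rest
-- turns a star representation into one of bounded degree.
module Submission where

open import Defs renaming (sym to adj-sym; irrefl to adj-irrefl)
open import Data.Bool as Bool using (Bool; true; false; not; if_then_else_)
open import Data.Bool.Properties using (T?; T-∧; T-irrelevant; ∧-zeroʳ)
open import Data.Empty using (⊥; ⊥-elim)
open import Data.Fin as Fin using (Fin; zero; suc; toℕ; fromℕ; inject₁; inject≤; combine; remQuot; punchIn; punchOut)
import Data.Fin.Properties as Finₚ
open import Data.Fin.Properties using (any?; all?)
open import Data.Fin.Relation.Unary.Top using (view; ‵fromℕ; ‵inject₁)
open import Data.List using (List; []; _∷_; _∷ʳ_; length; lookup; map; allFin; filterᵇ)
open import Data.List.Membership.Propositional using (_∈_; _∉_)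
import Data.List.Membership.DecPropositional as DecMembership
open import Data.List.Membership.Propositional.Properties using (∈-++⁻; ∈-++⁺ˡ; ∈-++⁺ʳ; ∈-lookup; ∈-filter⁺; ∈-filter⁻; ∈-map⁺; ∈-allFin)
open import Data.List.Properties using (length-map; length-tabulate)
open import Data.List.Relation.Unary.All as All using (All; []; _∷_)
import Data.List.Relation.Unary.All.Properties as Allₚ
open import Data.List.Relation.Unary.AllPairs using ([]; _∷_)
open import Data.List.Relation.Unary.Any using (here; there; index)
open import Data.List.Relation.Unary.Any.Properties using (lookup-index)
open import Data.List.Relation.Unary.Linked as Linked using (Linked; [-]; _∷_)
open import Data.List.Relation.Unary.Unique.Propositional using (Unique)
import Data.List.Relation.Unary.Unique.Propositional.Properties as Uniqueₚ
open import Data.Nat as ℕ using (ℕ; zero; suc; _+_; _*_; _≤_; _<_; z≤n; s≤s)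
open import Data.Nat.Induction using (<-wellFounded)
import Data.Nat.Properties as ℕₚ
open import Data.Product using (Σ; ∃; _×_; _,_; proj₁; proj₂)
open import Data.Product.Properties using (,-injectiveˡ; ,-injectiveʳ; ≡-dec)
open import Data.Sum using (_⊎_; inj₁; inj₂; swap)
open import Data.Unit using (⊤; tt)
open import Data.Vec.Functional as Vector using (updateAt)
open import Data.Vec.Functional.Properties using (updateAt-updates; updateAt-minimal)
open import Function using (_∘_; const; id; _⇔_; mk⇔; mk↔ₛ′; Equivalence; Inverse)
open import Induction.WellFounded using (Acc; acc)
open import Relation.Nullary using (¬_; Dec; yes; no; does)
open import Relation.Nullary.Decidable using (_×-dec_; _⊎-dec_; _→-dec_; ¬?; map′; does-⇔; dec-true; dec-false; decidable-stable)
open import Relation.Binary.Definitions using (DecidableEquality; tri<; tri≈; tri>)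
open import Relation.Binary.PropositionalEquality using (_≡_; _≢_; refl; sym; trans; cong; cong₂; subst; subst₂; ≢-sym)

-- Host trees are handled as parent functions with a rank, and paths as vertex sets with a top.
-- Surgery on the host is then a new parent function, and intersection arguments reduce to comparing
-- tops; lists of vertices occur only on entering and leaving this setting. The rank need not be the
-- depth, so a contraction can keep it. Nestedness is the condition for contracting because all
-- paths through the merged vertex must already have met pairwise, which holds if one of the two
-- sets of paths contains the other. The bound h ≥ 3 comes from the chains of a caterpillar: an
-- inner vertex has two neighbours on its chain and may carry one child. The centre has one
-- neighbour per colour, hence h. In a critical H every vertex has degree at least two. So G_H has
-- no vertex of the form `lvtx`, and every vertex j ≠ i of H has an edge avoiding i; this keeps the
-- path of v_i off the common vertex, and from separating other paths from it. Colourability is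
-- decided by search, so the case distinction on links and the choice of a critical subgraph are
-- constructive.

-- Rooted trees and the vertex sets of their paths

record RootedTree (A : Set) : Set where
  infix 4 _≟_
  field
    _≟_         : DecidableEquality A
    root        : A
    parent      : A → A
    rank        : A → ℕ
    parent-root : parent root ≡ root
    rank-parent : ∀ {x} → x ≢ root → rank (parent x) < rank x

  Child : A → A → Set
  Child a x = a ≢ root × parent a ≡ x

  Adj : A → A → Set
  Adj x y = Child x y ⊎ Child y x

  Child? : ∀ a x → Dec (Child a x)
  Child? a x = ¬? (a ≟ root) ×-dec (parent a ≟ x)

  Adj? : ∀ x y → Dec (Adj x y)
  Adj? x y = Child? x y ⊎-dec Child? y x

  child-< : ∀ {a x} → Child a x → rank x < rank a
  child-< (a≢r , refl) = rank-parent a≢r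

  child-irrefl : ∀ {a} → ¬ Child a a
  child-irrefl c = ℕₚ.<-irrefl refl (child-< c)

  Adj-irrefl : ∀ {x} → ¬ Adj x x
  Adj-irrefl (inj₁ c) = child-irrefl c
  Adj-irrefl (inj₂ c) = child-irrefl c

-- The vertex set of a path, seen from its vertex top closest to the root: every
-- vertex has at most one child on the path, except that top may have two.
record PathSet {A : Set} (T : RootedTree A) (S : A → Set) : Set where
  open RootedTree T
  field
    top  : A
    top∈ : S top
    up   : ∀ {x} → S x → x ≢ top → x ≢ root × S (parent x)
    one  : ∀ {a b} → S a → S b → a ≢ top → b ≢ top →
           parent a ≡ parent b → parent a ≢ top → a ≡ b
    two  : ∀ {a b c} → S a → S b → S c → a ≢ top → b ≢ top → c ≢ top →
           parent a ≡ top → parent b ≡ top → parent c ≡ top → a ≡ b ⊎ a ≡ c ⊎ b ≡ c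

  climb : (P : A → Set) → P top → (∀ {x} → S x → x ≢ top → P (parent x) → P x) →
          ∀ {x} → S x → P x
  climb P base next {x} = go x (<-wellFounded (rank x))
    where
    go : ∀ x → Acc _<_ (rank x) → S x → P x
    go x (acc rs) x∈ with x ≟ top
    ... | yes refl = base
    ... | no x≢t   = next x∈ x≢t
                       (go (parent x) (rs (rank-parent (proj₁ (up x∈ x≢t)))) (proj₂ (up x∈ x≢t)))

  top-min : ∀ {x} → S x → rank top ≤ rank x
  top-min = climb (λ x → rank top ≤ rank x) ℕₚ.≤-refl
    λ x∈ x≢t le → ℕₚ.≤-trans le (ℕₚ.<⇒≤ (rank-parent (proj₁ (up x∈ x≢t))))

  below≢top : ∀ {x y} → S x → rank x < rank y → y ≢ top
  below≢top x∈ lt refl = ℕₚ.<⇒≱ lt (top-min x∈)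

  child≢top : ∀ {a x} → S x → Child a x → a ≢ top
  child≢top x∈ c = below≢top x∈ (child-< c)

  -- At most one of the three is the parent of `x`. If one is, `x` is not the top and so has a
  -- single child on the path; if none is, three children are too many even for the top.
  no-claw : ∀ {x a b c} → S x → S a → S b → S c → Adj x a → Adj x b → Adj x c →
            a ≡ b ⊎ a ≡ c ⊎ b ≡ c
  no-claw {x} {a} {b} {c} x∈ a∈ b∈ c∈ = λ where
      (inj₁ (_ , refl)) (inj₁ (_ , refl)) _                 → inj₁ refl
      (inj₁ (_ , refl)) (inj₂ _)          (inj₁ (_ , refl)) → inj₂ (inj₁ refl)
      (inj₂ _)          (inj₁ (_ , refl)) (inj₁ (_ , refl)) → inj₂ (inj₂ refl)
      (inj₁ u)          (inj₂ v)          (inj₂ w)          → inj₂ (inj₂ (pair u v w a∈ b∈ c∈))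
      (inj₂ v)          (inj₁ u)          (inj₂ w)          → inj₂ (inj₁ (pair u v w b∈ a∈ c∈))
      (inj₂ v)          (inj₂ w)          (inj₁ u)          → inj₁ (pair u v w c∈ a∈ b∈)
      (inj₂ u)          (inj₂ v)          (inj₂ w)          → triple u v w
    where
    pair : ∀ {a b c} → Child x a → Child b x → Child c x → S a → S b → S c → b ≡ c
    pair u v w a∈ b∈ c∈ =
      one b∈ c∈ (child≢top x∈ v) (child≢top x∈ w) (trans (proj₂ v) (sym (proj₂ w)))
          (λ e → child≢top a∈ u (trans (sym (proj₂ v)) e))
    triple : Child a x → Child b x → Child c x → a ≡ b ⊎ a ≡ c ⊎ b ≡ c
    triple u v w with x ≟ top
    ... | yes refl = two a∈ b∈ c∈ (child≢top x∈ u) (child≢top x∈ v) (child≢top x∈ w)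
                         (proj₂ u) (proj₂ v) (proj₂ w)
    ... | no x≢t = inj₁ (one a∈ b∈ (child≢top x∈ u) (child≢top x∈ v)
                             (trans (proj₂ u) (sym (proj₂ v))) (λ e → x≢t (trans (sym (proj₂ u)) e)))

-- The invariant for building a path by prepending: the head is an end of the path, so it has no
-- child on it unless it is the top, and then at most one.
record HeadedPath {A : Set} (T : RootedTree A) (x : A) (xs : List A) : Set where
  open RootedTree T
  field
    pathSet   : PathSet T (_∈ (x ∷ xs))
    head-leaf : x ≢ PathSet.top pathSet → ∀ {a} → a ∈ (x ∷ xs) → ¬ Child a x
    head-one  : ∀ {a b} → a ∈ (x ∷ xs) → b ∈ (x ∷ xs) → Child a x → Child b x → a ≡ b
  open PathSet pathSet public

module _ {A : Set} (T : RootedTree A) where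
  open RootedTree T

  -- A head that is a child of the next vertex leaves the top unchanged. A head that is its parent
  -- becomes the top: were the next vertex not the old top, `up` would put the new head among the
  -- old vertices, against uniqueness.
  linked-path : ∀ x xs → Linked Adj (x ∷ xs) → Unique (x ∷ xs) → HeadedPath T x xs
  linked-path x [] _ _ = record
    { pathSet = record
      { top = x ; top∈ = here refl
      ; up = λ { (here refl) ne → ⊥-elim (ne refl) }
      ; one = λ { (here refl) _ ne → ⊥-elim (ne refl) }
      ; two = λ { (here refl) _ _ ne → ⊥-elim (ne refl) } }
    ; head-leaf = λ ne → ⊥-elim (ne refl)
    ; head-one = λ { (here refl) (here refl) _ _ → refl } }
  linked-path x (y ∷ ys) (inj₁ x↓y@(x≢r , px≡y) ∷ lk) un@(_ ∷ un′) = record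
    { pathSet = record
      { top = top ; top∈ = there top∈
      ; up = λ { (here refl) _ → x≢r , there (here px≡y)
               ; (there a∈) ne → let (nr , p∈) = up a∈ ne in nr , there p∈ }
      ; one = one′
      ; two = two′ }
    ; head-leaf = λ _ → leaf
    ; head-one = λ a∈ _ c _ → ⊥-elim (leaf a∈ c) }
    where
    open HeadedPath (linked-path y ys lk un′)
    x∉ : x ∉ (y ∷ ys)
    x∉ = Uniqueₚ.Unique[x∷xs]⇒x∉xs un
    leaf : ∀ {a} → a ∈ (x ∷ y ∷ ys) → ¬ Child a x
    leaf (here refl) c = child-irrefl c
    leaf {a} (there a∈) c@(_ , refl) with a ≟ top
    ... | no a≢t = x∉ (proj₂ (up a∈ a≢t))
    ... | yes refl = below≢top (here refl) (ℕₚ.<-trans (child-< x↓y) (child-< c)) refl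
    sibling : ∀ {b} → b ∈ (y ∷ ys) → b ≢ top → parent x ≡ parent b → parent x ≢ top → ⊥
    sibling b∈ b≢t e ne =
      head-leaf (λ y≡t → ne (trans px≡y y≡t)) b∈ (proj₁ (up b∈ b≢t) , trans (sym e) px≡y)
    one′ : ∀ {a b} → a ∈ (x ∷ y ∷ ys) → b ∈ (x ∷ y ∷ ys) → a ≢ top → b ≢ top →
           parent a ≡ parent b → parent a ≢ top → a ≡ b
    one′ (here refl) (here refl) _ _ _ _ = refl
    one′ (here refl) (there b∈) _ b≢t e ne = ⊥-elim (sibling b∈ b≢t e ne)
    one′ (there a∈) (here refl) a≢t _ e ne =
      ⊥-elim (sibling a∈ a≢t (sym e) (λ e′ → ne (trans e e′)))
    one′ (there a∈) (there b∈) a≢t b≢t e ne = one a∈ b∈ a≢t b≢t e ne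
    pair : ∀ {b c} → b ∈ (y ∷ ys) → c ∈ (y ∷ ys) → b ≢ top → c ≢ top →
           parent x ≡ top → parent b ≡ top → parent c ≡ top → b ≡ c
    pair b∈ c∈ b≢t c≢t ex eb ec =
      head-one b∈ c∈ (proj₁ (up b∈ b≢t) , trans eb (trans (sym ex) px≡y))
                     (proj₁ (up c∈ c≢t) , trans ec (trans (sym ex) px≡y))
    two′ : ∀ {a b c} → a ∈ (x ∷ y ∷ ys) → b ∈ (x ∷ y ∷ ys) → c ∈ (x ∷ y ∷ ys) →
           a ≢ top → b ≢ top → c ≢ top →
           parent a ≡ top → parent b ≡ top → parent c ≡ top → a ≡ b ⊎ a ≡ c ⊎ b ≡ c
    two′ (here refl) (here refl) _ _ _ _ _ _ _ = inj₁ refl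
    two′ (here refl) (there _) (here refl) _ _ _ _ _ _ = inj₂ (inj₁ refl)
    two′ (there _) (here refl) (here refl) _ _ _ _ _ _ = inj₂ (inj₂ refl)
    two′ (here refl) (there b∈) (there c∈) _ nb nc ea eb ec = inj₂ (inj₂ (pair b∈ c∈ nb nc ea eb ec))
    two′ (there a∈) (here refl) (there c∈) na _ nc ea eb ec = inj₂ (inj₁ (pair a∈ c∈ na nc eb ea ec))
    two′ (there a∈) (there b∈) (here refl) na nb _ ea eb ec = inj₁ (pair a∈ b∈ na nb ec ea eb)
    two′ (there a∈) (there b∈) (there c∈) na nb nc ea eb ec = two a∈ b∈ c∈ na nb nc ea eb ec
  linked-path x (y ∷ ys) (inj₂ y↓x@(y≢r , py≡x) ∷ lk) un@(_ ∷ un′) = record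
    { pathSet = record
      { top = x ; top∈ = here refl
      ; up = up′
      ; one = one′
      ; two = λ { (here refl) _ _ ne → ⊥-elim (ne refl)
                ; (there _) (here refl) _ _ ne → ⊥-elim (ne refl)
                ; (there a∈) (there b∈) _ _ _ _ ea eb _ →
                    inj₁ (trans (child≡y a∈ ea) (sym (child≡y b∈ eb))) } }
    ; head-leaf = λ ne → ⊥-elim (ne refl)
    ; head-one = λ { (here refl) _ c _ → ⊥-elim (child-irrefl c)
                   ; (there _) (here refl) _ c → ⊥-elim (child-irrefl c)
                   ; (there a∈) (there b∈) (_ , ea) (_ , eb) →
                       trans (child≡y a∈ ea) (sym (child≡y b∈ eb)) } }
    where
    open HeadedPath (linked-path y ys lk un′)
    x∉ : x ∉ (y ∷ ys)
    x∉ = Uniqueₚ.Unique[x∷xs]⇒x∉xs un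
    top≡ : ∀ {a} → a ∈ (y ∷ ys) → parent a ≡ x → a ≡ top
    top≡ {a} a∈ refl with a ≟ top
    ... | yes e = e
    ... | no ne = ⊥-elim (x∉ (proj₂ (up a∈ ne)))
    y≡top : y ≡ top
    y≡top = top≡ (here refl) py≡x
    child≡y : ∀ {a} → a ∈ (y ∷ ys) → parent a ≡ x → a ≡ y
    child≡y a∈ e = trans (top≡ a∈ e) (sym y≡top)
    up′ : ∀ {a} → a ∈ (x ∷ y ∷ ys) → a ≢ x → a ≢ root × parent a ∈ (x ∷ y ∷ ys)
    up′ (here refl) ne = ⊥-elim (ne refl)
    up′ {a} (there a∈) _ with a ≟ top
    ... | no a≢t = let (nr , p∈) = up a∈ a≢t in nr , there p∈
    ... | yes a≡t with trans a≡t (sym y≡top)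
    ...   | refl = y≢r , here py≡x
    one′ : ∀ {a b} → a ∈ (x ∷ y ∷ ys) → b ∈ (x ∷ y ∷ ys) → a ≢ x → b ≢ x →
           parent a ≡ parent b → parent a ≢ x → a ≡ b
    one′ (here refl) _ ne = ⊥-elim (ne refl)
    one′ (there _) (here refl) _ ne = ⊥-elim (ne refl)
    one′ {a} {b} (there a∈) (there b∈) _ _ e pa≢x with parent a ≟ top
    ... | no ne = one a∈ b∈ (≢top a refl) (≢top b (sym e)) e ne
      where
      ≢top : ∀ c → parent c ≡ parent a → c ≢ top
      ≢top c e′ c≡t = pa≢x (trans (sym e′) (trans (cong parent (trans c≡t (sym y≡top))) py≡x))
    ... | yes pa≡t = head-one a∈ b∈ (child a a∈ refl) (child b b∈ (sym e))
      where
      child : ∀ c → c ∈ (y ∷ ys) → parent c ≡ parent a → Child c y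
      child c c∈ e′ =
        proj₁ (up c∈ λ c≡t → pa≢x (trans (sym e′) (trans (cong parent (trans c≡t (sym y≡top))) py≡x)))
        , trans e′ (trans pa≡t (sym y≡top))

-- Counting and saturating finite sets

count : ∀ {m} → (Fin m → Bool) → ℕ
count {zero}  f = 0
count {suc m} f = (if f zero then 1 else 0) + count (f ∘ suc)

bit-mono : ∀ {a b} → (a ≡ true → b ≡ true) →
           (if a then 1 else 0) ≤ (if b then 1 else 0)
bit-mono {false}         _   = z≤n
bit-mono {true}  {true}  _   = ℕₚ.≤-refl
bit-mono {true}  {false} imp with imp refl
... | ()

count-mono : ∀ {m} {f g : Fin m → Bool} → (∀ x → f x ≡ true → g x ≡ true) → count f ≤ count g
count-mono {zero}  imp = z≤n
count-mono {suc m} imp = ℕₚ.+-mono-≤ (bit-mono (imp zero)) (count-mono (imp ∘ suc))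

count-strict : ∀ {m} {f g : Fin m → Bool} → (∀ x → f x ≡ true → g x ≡ true) →
               ∀ y → f y ≡ false → g y ≡ true → count f < count g
count-strict {f = f} {g} imp zero fy gy rewrite fy | gy = s≤s (count-mono (imp ∘ suc))
count-strict imp (suc y) fy gy =
  ℕₚ.+-mono-≤-< (bit-mono (imp zero)) (count-strict (imp ∘ suc) y fy gy)

insert : ∀ {m} → Fin m → (Fin m → Bool) → Fin m → Bool
insert y A = updateAt A y (const true)

module _ {m} (A : Fin m → Bool) (y : Fin m) where
  insert-same : insert y A y ≡ true
  insert-same = updateAt-updates y A

  insert-⊇ : ∀ x → A x ≡ true → insert y A x ≡ true
  insert-⊇ x x∈ with x Finₚ.≟ y
  ... | yes refl = insert-same
  ... | no ne = trans (updateAt-minimal x y A ne) x∈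

  insert⁻ : ∀ {x} → insert y A x ≡ true → x ≡ y ⊎ (x ≢ y × A x ≡ true)
  insert⁻ {x} x∈ with x Finₚ.≟ y
  ... | yes e = inj₁ e
  ... | no ne = inj₂ (ne , trans (sym (updateAt-minimal x y A ne)) x∈)

∈∉⇒≢ : ∀ {m} {A : Fin m → Bool} {x y} → A x ≡ true → A y ≡ false → x ≢ y
∈∉⇒≢ x∈ y∉ refl with trans (sym x∈) y∉
... | ()

Closed : ∀ {m} → (Fin m → Fin m → Set) → (Fin m → Bool) → Set
Closed R A = ∀ {x y} → A x ≡ true → R x y → A y ≡ true

-- Terminates because each insertion shrinks the complement. The invariant `P` may carry data, so
-- the same loop grows a rooted tree, orders a path as a list and computes a component.
saturate : ∀ {m} {R : Fin m → Fin m → Set} → (∀ x y → Dec (R x y)) →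
           (P : (Fin m → Bool) → Set) →
           (∀ {A x y} → P A → A x ≡ true → A y ≡ false → R x y → P (insert y A)) →
           ∀ A → P A → Σ (Fin m → Bool) λ B → P B × (∀ x → A x ≡ true → B x ≡ true) × Closed R B
saturate {m} {R} R? P extend A₀ = go A₀ (<-wellFounded _)
  where
  go : ∀ A → Acc _<_ (count (not ∘ A)) → P A →
       Σ (Fin m → Bool) λ B → P B × (∀ x → A x ≡ true → B x ≡ true) × Closed R B
  go A (acc rs) PA
    with any? (λ x → any? λ y → (A x Bool.≟ true) ×-dec (A y Bool.≟ false) ×-dec R? x y)
  ... | yes (x , y , x∈ , y∉ , xy) =
    let B , PB , ⊆B , closed = go (insert y A) (rs smaller) (extend PA x∈ y∉ xy)
    in B , PB , (λ z → ⊆B z ∘ insert-⊇ A y z) , closed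
    where
    smaller : count (not ∘ insert y A) < count (not ∘ A)
    smaller = count-strict
      (λ z nz → shrink z nz) y (cong not (insert-same A y)) (cong not y∉)
      where
      shrink : ∀ z → not (insert y A z) ≡ true → not (A z) ≡ true
      shrink z nz with A z in eq
      ... | false = refl
      ... | true with trans (sym (cong not (insert-⊇ A y z eq))) nz
      ...   | ()
  ... | no none = A , PA , (λ _ x∈ → x∈) , closed
    where
    closed : Closed R A
    closed {x} {y} x∈ xy with A y in eq
    ... | true = refl
    ... | false = ⊥-elim (none (x , y , x∈ , eq , xy))

-- Walks, and rooting a finite tree

module _ (G : Graph) where

  E-sym : ∀ {x y} → E G x y → E G y x
  E-sym {x} {y} = subst Bool.T (adj-sym G x y)

  E-irrefl : ∀ {x} → ¬ E G x x
  E-irrefl {x} e = subst Bool.T (adj-irrefl G x) e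

  E? : ∀ x y → Dec (E G x y)
  E? x y = T? (adj G x y)

  reach-closed : ∀ {A} → Closed (E G) A → ∀ {x y} → Reach G x y → A x ≡ true → A y ≡ true
  reach-closed closed here       x∈ = x∈
  reach-closed closed (step e r) x∈ = reach-closed closed r (closed x∈ e)

  reach-trans : ∀ {x y z} → Reach G x y → Reach G y z → Reach G x z
  reach-trans here       s = s
  reach-trans (step e r) s = step e (reach-trans r s)

  reach-sym : ∀ {x y} → Reach G x y → Reach G y x
  reach-sym here       = here
  reach-sym (step e r) = reach-trans (reach-sym r) (step (E-sym e) here)

  data Walk : Fin (n G) → Fin (n G) → List (Fin (n G)) → Set where
    stop : ∀ {x} → Walk x x (x ∷ [])
    _◅_  : ∀ {x y z l} → E G x y → Walk y z l → Walk x z (x ∷ l)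

  walk-snoc : ∀ {x y z l} → Walk x y l → E G y z → Walk x z (l ∷ʳ z)
  walk-snoc stop    f = f ◅ stop
  walk-snoc (e ◅ w) f = e ◅ walk-snoc w f

  walk-linked : ∀ {x y l} → Walk x y l → Linked (E G) l
  walk-linked stop               = [-]
  walk-linked (e ◅ stop)         = e ∷ [-]
  walk-linked (e ◅ w@(_ ◅ _))    = e ∷ walk-linked w

  walk-long : ∀ {x y l} → x ≢ y → Walk x y l → 2 ≤ length l
  walk-long ne stop          = ⊥-elim (ne refl)
  walk-long ne (e ◅ stop)    = s≤s (s≤s z≤n)
  walk-long ne (e ◅ (_ ◅ _)) = s≤s (s≤s z≤n)

  walk-head : ∀ {x y z l} → E G z x → Walk x y l → Linked (E G) (z ∷ l)
  walk-head e stop    = e ∷ [-]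
  walk-head e (f ◅ w) = e ∷ walk-linked (f ◅ w)

unique-snoc : ∀ {A : Set} {l : List A} {y} → Unique l → y ∉ l → Unique (l ∷ʳ y)
unique-snoc u y∉ = Uniqueₚ.++⁺ u ([] ∷ []) λ { (y∈ , here refl) → y∉ y∈ }

module Rooting (G : Graph) (acyclic : Acyclic G) (q : Fin (n G)) where

  -- A tree grown from q inside G; the simple walks between its vertices are what
  -- closes a cycle should a new vertex have two neighbours in the tree.
  record Partial (A : Fin (n G) → Bool) : Set where
    field
      par    : Fin (n G) → Fin (n G)
      rk     : Fin (n G) → ℕ
      par-q  : par q ≡ q
      q∈     : A q ≡ true
      par-ok : ∀ {x} → A x ≡ true → x ≢ q → E G x (par x) × A (par x) ≡ true × rk (par x) < rk x
      edges  : ∀ {x y} → A x ≡ true → A y ≡ true → E G x y →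
               (x ≢ q × par x ≡ y) ⊎ (y ≢ q × par y ≡ x)
      walks  : ∀ {x y} → A x ≡ true → A y ≡ true →
               ∃ λ l → Walk G x y l × Unique l × All (λ z → A z ≡ true) l

  start : Partial (insert q (const false))
  start = record
    { par = λ x → x ; rk = const 0 ; par-q = refl ; q∈ = insert-same _ q
    ; par-ok = λ x∈ ne → ⊥-elim (ne (is-q x∈))
    ; edges = λ x∈ y∈ e → loop (is-q x∈) (is-q y∈) e
    ; walks = λ x∈ y∈ → trivial (is-q x∈) (is-q y∈) }
    where
    is-q : ∀ {x} → insert q (const false) x ≡ true → x ≡ q
    is-q x∈ with insert⁻ (const false) _ x∈
    ... | inj₁ e = e
    loop : ∀ {x y} {B : Set} → x ≡ q → y ≡ q → E G x y → B
    loop refl refl e = ⊥-elim (E-irrefl G e)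
    trivial : ∀ {x y} → x ≡ q → y ≡ q → ∃ λ l → Walk G x y l × Unique l ×
              All (λ z → insert q (const false) z ≡ true) l
    trivial refl refl = q ∷ [] , stop , [] ∷ [] , insert-same _ q ∷ []

  extend : ∀ {A x y} → Partial A → A x ≡ true → A y ≡ false → E G x y → Partial (insert y A)
  extend {A} {x} {y} P x∈ y∉ xy = record
    { par = par′ ; rk = rk′
    ; par-q = trans (par-old (≢y q∈)) par-q
    ; q∈ = insert-⊇ A y q q∈
    ; par-ok = par-ok′ ; edges = edges′ ; walks = walks′ }
    where
    open Partial P
    par′ = updateAt par y (const x)
    rk′ = updateAt rk y (const (suc (rk x)))
    ≢y : ∀ {z} → A z ≡ true → z ≢ y
    ≢y z∈ = ∈∉⇒≢ {A = A} z∈ y∉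
    par-old : ∀ {z} → z ≢ y → par′ z ≡ par z
    par-old ne = updateAt-minimal _ y par ne
    rk-old : ∀ {z} → z ≢ y → rk′ z ≡ rk z
    rk-old ne = updateAt-minimal _ y rk ne
    par-new : par′ y ≡ x
    par-new = updateAt-updates y par
    par-ok′ : ∀ {z} → insert y A z ≡ true → z ≢ q →
              E G z (par′ z) × insert y A (par′ z) ≡ true × rk′ (par′ z) < rk′ z
    par-ok′ {z} z∈ z≢q with insert⁻ A _ z∈
    ... | inj₁ refl rewrite par-new | rk-old (≢y x∈) | updateAt-updates z {f = const (suc (rk x))} rk =
      E-sym G xy , insert-⊇ A y x x∈ , ℕₚ.n<1+n _
    ... | inj₂ (ne , z∈A) with par-ok z∈A z≢q
    ...   | e , p∈ , lt rewrite par-old ne | rk-old ne | rk-old (≢y p∈) = e , insert-⊇ A y _ p∈ , lt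
    unique-nbr : ∀ {z} → A z ≡ true → E G z y → z ≡ x
    unique-nbr {z} z∈ zy with z Finₚ.≟ x
    ... | yes e = e
    ... | no z≢x with walks z∈ x∈
    ...   | l , w , u , l⊆ = ⊥-elim (acyclic (y ∷ l)
              ( walk-long G z≢x w
              , All.map (λ v∈ → ≢-sym (≢y v∈)) l⊆ ∷ u
              , walk-head G (E-sym G zy) (walk-snoc G w xy)))
    edges′ : ∀ {u v} → insert y A u ≡ true → insert y A v ≡ true → E G u v →
             (u ≢ q × par′ u ≡ v) ⊎ (v ≢ q × par′ v ≡ u)
    edges′ u∈ v∈ uv with insert⁻ A _ u∈ | insert⁻ A _ v∈
    ... | inj₁ refl | inj₁ refl = ⊥-elim (E-irrefl G uv)
    ... | inj₁ refl | inj₂ (_ , v∈A) =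
      inj₁ (≢-sym (≢y q∈) , trans par-new (sym (unique-nbr v∈A (E-sym G uv))))
    ... | inj₂ (_ , u∈A) | inj₁ refl =
      inj₂ (≢-sym (≢y q∈) , trans par-new (sym (unique-nbr u∈A uv)))
    ... | inj₂ (u≢y , u∈A) | inj₂ (v≢y , v∈A) rewrite par-old u≢y | par-old v≢y = edges u∈A v∈A uv
    y∉l : ∀ {l} → All (λ z → A z ≡ true) l → y ∉ l
    y∉l l⊆ y∈ = ≢y (All.lookup l⊆ y∈) refl
    grow-All : ∀ {l} → All (λ z → A z ≡ true) l → All (λ z → insert y A z ≡ true) l
    grow-All = All.map (λ {z} → insert-⊇ A y z)
    walks′ : ∀ {u v} → insert y A u ≡ true → insert y A v ≡ true →
             ∃ λ l → Walk G u v l × Unique l × All (λ z → insert y A z ≡ true) l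
    walks′ u∈ v∈ with insert⁻ A _ u∈ | insert⁻ A _ v∈
    ... | inj₁ refl | inj₁ refl = y ∷ [] , stop , [] ∷ [] , insert-same A y ∷ []
    ... | inj₁ refl | inj₂ (_ , v∈A) = let l , w , u , l⊆ = walks x∈ v∈A in
      y ∷ l , E-sym G xy ◅ w , All.map (λ z∈ → ≢-sym (≢y z∈)) l⊆ ∷ u , insert-same A y ∷ grow-All l⊆
    ... | inj₂ (_ , u∈A) | inj₁ refl = let l , w , u , l⊆ = walks u∈A x∈ in
      l ∷ʳ y , walk-snoc G w xy , unique-snoc u (y∉l l⊆) , Allₚ.++⁺ (grow-All l⊆) (insert-same A y ∷ [])
    ... | inj₂ (_ , u∈A) | inj₂ (_ , v∈A) = let l , w , u , l⊆ = walks u∈A v∈A in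
      l , w , u , grow-All l⊆

  rooted : Connected G → Σ (RootedTree (Fin (n G))) λ T → RootedTree.root T ≡ q ×
           (∀ {x y} → E G x y → RootedTree.Adj T x y) × (∀ {x} → x ≢ q → E G x (RootedTree.parent T x))
  rooted conn with saturate (E? G) Partial extend _ start
  ... | B , P , ⊆B , closed = record
      { _≟_ = Finₚ._≟_ ; root = q ; parent = par ; rank = rk ; parent-root = par-q
      ; rank-parent = λ ne → proj₂ (proj₂ (par-ok (all∈ _) ne)) }
    , refl , edges (all∈ _) (all∈ _) , (λ ne → proj₁ (par-ok (all∈ _) ne))
    where
    open Partial P
    all∈ : ∀ x → B x ≡ true
    all∈ x = reach-closed G closed (conn q x) q∈

does⁻ : ∀ {P : Set} (d : Dec P) → Bool.T (does d) → P
does⁻ (yes p) _ = p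

does⁺ : ∀ {P : Set} (d : Dec P) → P → Bool.T (does d)
does⁺ (yes _) _ = _
does⁺ (no ¬p) p = ⊥-elim (¬p p)

-- Representations over rooted trees, and the way back to host graphs

-- Paths are decidable predicates rather than lists, so changing the tree requires no ordering of
-- their vertices; `path-list` recovers the order at the end. The vertex type is free because
-- splitting produces triples.
record Representation (G : Graph) (A : Set) : Set₁ where
  field
    tree : RootedTree A
    S    : Fin (n G) → A → Set
    S?   : ∀ v x → Dec (S v x)
    paths : ∀ v → PathSet tree (S v)
    meet : ∀ u v → u ≢ v → E G u v ⇔ (∃ λ x → S u x × S v x)
  open RootedTree tree public

-- The root `q` is left to the caller, so that a host can be rooted again at a vertex found in
-- another rooting; the equation for `S` carries facts between the two.
fromVPT : ∀ {G} (R : VPTRep G) (q : Fin (n (host R))) →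
          Σ (Representation G (Fin (n (host R)))) λ P →
            Representation.root P ≡ q ×
            (∀ {x} → x ≢ q → E (host R) x (Representation.parent P x)) ×
            (∀ v → Representation.S P v ≡ (_∈ path R v))
fromVPT {G} R q with Rooting.rooted (host R) (proj₂ (hostTree R)) q (proj₁ (hostTree R))
... | T , root≡q , edge⇒adj , parent-edge = record
    { tree = T ; S = λ v x → x ∈ path R v ; S? = λ v x → x ∈? path R v
    ; paths = λ v → list-path (path R v) (pathIsPath R v)
    ; meet = correct R }
  , root≡q , parent-edge , (λ _ → refl)
  where
  open DecMembership (Finₚ._≟_ {n (host R)}) using (_∈?_)
  list-path : ∀ l → IsPath (host R) l → PathSet T (_∈ l)
  list-path []       (ne , _)      = ⊥-elim (ne refl)
  list-path (x ∷ xs) (_ , un , lk) = HeadedPath.pathSet (linked-path T x xs (Linked.map edge⇒adj lk) un)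

module _ {A : Set} {R : A → A → Set} where

  linked-snoc : ∀ {l x y} → Linked R (l ∷ʳ x) → R x y → Linked R ((l ∷ʳ x) ∷ʳ y)
  linked-snoc {[]}        [-]      r = r ∷ [-]
  linked-snoc {_ ∷ []}    (e ∷ lk) r = e ∷ linked-snoc {[]} lk r
  linked-snoc {_ ∷ _ ∷ _} (e ∷ lk) r = e ∷ linked-snoc {_ ∷ _} lk r

  -- The final proviso serves cycles: with at least three vertices, the two neighbours of the vertex
  -- where the cycle is cut open are distinct.
  linked-unsnoc : ∀ {y ys z} → Linked R ((y ∷ ys) ∷ʳ z) →
                  Linked R (y ∷ ys) × ∃ λ k → k ∈ (y ∷ ys) × R k z × (1 ≤ length ys → k ∈ ys)
  linked-unsnoc {y} {[]}     (r ∷ _)  = [-] , y , here refl , r , λ ()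
  linked-unsnoc {y} {_ ∷ _}  (e ∷ lk) =
    let lk′ , k , k∈ , r , _ = linked-unsnoc lk in e ∷ lk′ , k , there k∈ , r , λ _ → k∈

  -- A list can be extended only at its ends. At an inner vertex a new neighbour would be a third
  -- one, which `no-claw` excludes.
  ends-or-inner : (∀ {x y} → R x y → R y x) → ∀ {l x} → Linked R l → Unique l → x ∈ l →
                  (∃ λ l′ → l ≡ x ∷ l′) ⊎ (∃ λ l′ → l ≡ l′ ∷ʳ x) ⊎
                  (∃ λ a → ∃ λ b → a ∈ l × b ∈ l × a ≢ b × R x a × R x b)
  ends-or-inner _ _ _ (here refl) = inj₁ (_ , refl)
  ends-or-inner Rsym {w ∷ y ∷ ys} (e ∷ lk) (w≢ ∷ un) (there x∈) with ends-or-inner Rsym lk un x∈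
  ... | inj₁ ([] , refl)     = inj₂ (inj₁ (w ∷ [] , refl))
  ... | inj₁ (z ∷ l′ , refl) with lk
  ...   | f ∷ _ = inj₂ (inj₂ (w , z , here refl , there (there (here refl))
                               , All.lookup w≢ (there (here refl)) , Rsym e , f))
  ends-or-inner Rsym {w ∷ y ∷ ys} (e ∷ lk) (w≢ ∷ un) (there x∈)
      | inj₂ (inj₁ (l′ , eq)) = inj₂ (inj₁ (w ∷ l′ , cong (w ∷_) eq))
  ends-or-inner Rsym {w ∷ y ∷ ys} (e ∷ lk) (w≢ ∷ un) (there x∈)
      | inj₂ (inj₂ (a , b , a∈ , b∈ , rest)) = inj₂ (inj₂ (a , b , there a∈ , there b∈ , rest))

lookup-unique : ∀ {A : Set} {l : List A} → Unique l → ∀ i j → lookup l i ≡ lookup l j → i ≡ j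
lookup-unique (_ ∷ _) zero    zero    _ = refl
lookup-unique {l = _ ∷ l} (x≢ ∷ _) zero    (suc j) e = ⊥-elim (All.lookup x≢ (∈-lookup {xs = l} j) e)
lookup-unique {l = _ ∷ l} (x≢ ∷ _) (suc i) zero    e = ⊥-elim (All.lookup x≢ (∈-lookup {xs = l} i) (sym e))
lookup-unique (_ ∷ u) (suc i) (suc j) e = cong suc (lookup-unique u i j e)

unique-⊆-length : ∀ {A : Set} {xs ys : List A} → Unique xs → (∀ {x} → x ∈ xs → x ∈ ys) →
                  length xs ≤ length ys
unique-⊆-length {xs = xs} {ys} u sub = Finₚ.injective⇒≤ {f = λ i → index (sub (∈-lookup {xs = xs} i))}
  λ {i} {j} e → lookup-unique u i j
    (trans (lookup-index (sub (∈-lookup i)))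
           (trans (cong (lookup ys) e) (sym (lookup-index (sub (∈-lookup j))))))

module _ (G : Graph) where

  neighbours : Fin (n G) → List (Fin (n G))
  neighbours x = filterᵇ (adj G x) (allFin (n G))

  neighbours-unique : ∀ x → Unique (neighbours x)
  neighbours-unique x = Uniqueₚ.filter⁺ (T? ∘ adj G x) (Uniqueₚ.allFin⁺ (n G))

  degree-≤ : ∀ x l → (∀ {y} → E G x y → y ∈ l) → degree G x ≤ length l
  degree-≤ x l sub = unique-⊆-length (neighbours-unique x)
    λ y∈ → sub (proj₂ (∈-filter⁻ (T? ∘ adj G x) {xs = allFin (n G)} y∈))

module TreeGraph {m : ℕ} (T : RootedTree (Fin m)) where
  open RootedTree T

  graph : Graph
  graph = record
    { n      = m
    ; adj    = λ x y → does (Adj? x y)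
    ; sym    = λ x y → does-⇔ (mk⇔ swap swap) (Adj? x y) (Adj? y x)
    ; irrefl = λ x → dec-false (Adj? x x) Adj-irrefl }

  toAdj : ∀ {x y} → E graph x y → Adj x y
  toAdj = does⁻ (Adj? _ _)

  fromAdj : ∀ {x y} → Adj x y → E graph x y
  fromAdj = does⁺ (Adj? _ _)

  to-root : ∀ x → Reach graph x root
  to-root x = go x (<-wellFounded (rank x))
    where
    go : ∀ x → Acc _<_ (rank x) → Reach graph x root
    go x (acc rs) with x ≟ root
    ... | yes refl = here
    ... | no ne = step (fromAdj (inj₁ (ne , refl))) (go (parent x) (rs (rank-parent ne)))

  connected : Connected graph
  connected x y = reach-trans graph (to-root x) (reach-sym graph (to-root y))

  -- The head of the path obtained by cutting the cycle open at x has both its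
  -- neighbours on the path, which the shape of headed paths excludes.
  acyclic : Acyclic graph
  acyclic [] ()
  acyclic (x ∷ y ∷ ys) (s≤s long , un@(_ ∷ (y≢ ∷ _)) , e ∷ lk) with linked-unsnoc lk
  ... | lk′ , k , k∈ , kx , inner = contra (toAdj e) (toAdj kx)
    where
    open HeadedPath (linked-path T x (y ∷ ys) (Linked.map toAdj (e ∷ lk′)) un)
    y≢k : y ≢ k
    y≢k = All.lookup y≢ (inner long)
    noChild : ∀ {a b} → a ∈ (x ∷ y ∷ ys) → b ∈ (x ∷ y ∷ ys) → Child a x → Adj x b → a ≡ b
    noChild a∈ b∈ c adj-b with x ≟ top
    ... | no x≢t = ⊥-elim (head-leaf x≢t a∈ c)
    noChild a∈ b∈ c (inj₂ d) | yes _ = head-one a∈ b∈ c d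
    noChild a∈ b∈ c (inj₁ d) | yes x≡t = ⊥-elim (below≢top b∈ (child-< d) x≡t)
    contra : Adj x y → Adj k x → ⊥
    contra a (inj₁ c) = y≢k (sym (noChild (there k∈) (there (here refl)) c a))
    contra (inj₂ c) (inj₂ d) = y≢k (noChild (there (here refl)) (there k∈) c (inj₁ d))
    contra (inj₁ (_ , p)) (inj₂ (_ , p′)) = y≢k (trans (sym p) p′)

  module _ {S : Fin m → Set} (S? : ∀ x → Dec (S x)) (P : PathSet T S) where
    open PathSet P

    private
      Listed : (Fin m → Bool) → Set
      Listed A = ∃ λ l → Unique l × Linked Adj l × All S l × top ∈ l ×
                 (∀ x → x ∈ l → A x ≡ true) × (∀ x → A x ≡ true → x ∈ l)

      Next : Fin m → Fin m → Set
      Next x y = Adj x y × S y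

      listed-top : Listed (insert top (const false))
      listed-top = top ∷ [] , [] ∷ [] , [-] , top∈ ∷ [] , here refl
        , (λ { x (here refl) → insert-same _ x })
        , λ x x∈ → single (insert⁻ (const false) top x∈)
        where
        single : ∀ {x} → x ≡ top ⊎ (x ≢ top × false ≡ true) → x ∈ (top ∷ [])
        single (inj₁ refl) = here refl

      grow : ∀ {A x y} → Listed A → A x ≡ true → A y ≡ false → Next x y → Listed (insert y A)
      grow {A} {x} {y} (l , un , lk , l⊆S , t∈ , l⊆A , A⊆l) x∈ y∉A (xy , y∈S)
        with ends-or-inner swap lk un (A⊆l x x∈)
      ... | inj₁ (l′ , refl) =
          y ∷ l , All.tabulate (λ z∈ → λ { refl → y∉ z∈ }) ∷ un , swap xy ∷ lk , y∈S ∷ l⊆S , there t∈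
        , (λ { z (here refl) → insert-same A z ; z (there z∈) → insert-⊇ A y z (l⊆A z z∈) })
        , λ z z∈ → old z (insert⁻ A y z∈)
        where
        y∉ : y ∉ l
        y∉ y∈ = ∈∉⇒≢ {A = A} (l⊆A y y∈) y∉A refl
        old : ∀ z → z ≡ y ⊎ (z ≢ y × A z ≡ true) → z ∈ (y ∷ l)
        old z (inj₁ refl) = here refl
        old z (inj₂ (_ , z∈)) = there (A⊆l z z∈)
      ... | inj₂ (inj₁ (l′ , refl)) =
          l ∷ʳ y , unique-snoc un y∉ , linked-snoc {l = l′} lk xy
        , All.tabulate (λ z∈ → inS (∈-++⁻ l z∈)) , ∈-++⁺ˡ t∈
        , (λ z z∈ → new z (∈-++⁻ l z∈)) , λ z z∈ → old z (insert⁻ A y z∈)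
        where
        y∉ : y ∉ l
        y∉ y∈ = ∈∉⇒≢ {A = A} (l⊆A y y∈) y∉A refl
        inS : ∀ {z} → z ∈ l ⊎ z ∈ (y ∷ []) → S z
        inS (inj₁ z∈) = All.lookup l⊆S z∈
        inS (inj₂ (here refl)) = y∈S
        new : ∀ z → z ∈ l ⊎ z ∈ (y ∷ []) → insert y A z ≡ true
        new z (inj₁ z∈) = insert-⊇ A y z (l⊆A z z∈)
        new z (inj₂ (here refl)) = insert-same A z
        old : ∀ z → z ≡ y ⊎ (z ≢ y × A z ≡ true) → z ∈ (l ∷ʳ y)
        old z (inj₁ refl) = ∈-++⁺ʳ l (here refl)
        old z (inj₂ (_ , z∈)) = ∈-++⁺ˡ (A⊆l z z∈)
      ... | inj₂ (inj₂ (a , b , a∈ , b∈ , a≢b , xa , xb)) =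
        ⊥-elim (claw (no-claw (All.lookup l⊆S (A⊆l x x∈)) (All.lookup l⊆S a∈) (All.lookup l⊆S b∈)
                              y∈S xa xb xy))
        where
        y∉ : y ∉ l
        y∉ y∈ = ∈∉⇒≢ {A = A} (l⊆A y y∈) y∉A refl
        claw : ¬ (a ≡ b ⊎ a ≡ y ⊎ b ≡ y)
        claw (inj₁ e) = a≢b e
        claw (inj₂ (inj₁ refl)) = y∉ a∈
        claw (inj₂ (inj₂ refl)) = y∉ b∈

    -- Saturating from the top along adjacent members of `S` yields a list in path order; since
    -- every member climbs to the top inside `S`, none is missed.
    path-list : ∃ λ l → IsPath graph l × (∀ x → x ∈ l → S x) × (∀ x → S x → x ∈ l)
    path-list with saturate (λ x y → Adj? x y ×-dec S? y) Listed grow _ listed-top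
    ... | B , (l , un , lk , l⊆S , t∈ , l⊆B , B⊆l) , _ , closed =
        l , (nonempty t∈ , un , Linked.map fromAdj lk) , (λ x → All.lookup l⊆S)
      , λ x x∈ → B⊆l x (climb (λ x → B x ≡ true) (l⊆B top t∈)
          (λ {x} x∈S x≢t p∈ → closed p∈ (inj₂ (proj₁ (up x∈S x≢t) , refl) , x∈S)) x∈)
      where
      nonempty : ∀ {x} {l : List (Fin m)} → x ∈ l → ¬ (l ≡ [])
      nonempty () refl

toIn : ∀ {G m h} (R : Representation G (Fin m)) → let open Representation R in
       (∀ x → ∃ λ l → (∀ {y} → Adj x y → y ∈ l) × length l ≤ h) → In[ h ,2,1] G
toIn {G} R deg = record
    { host = graph ; hostTree = connected , acyclic
    ; path = λ v → proj₁ (lists v) ; pathIsPath = λ v → proj₁ (proj₂ (lists v))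
    ; correct = λ u v u≢v → let open Equivalence (meet u v u≢v) in mk⇔
        (λ e → let x , xu , xv = to e in x , in-list u x xu , in-list v x xv)
        (λ { (x , xu , xv) → from (x , from-list u x xu , from-list v x xv) }) }
  , λ x → let l , sub , le = deg x in ℕₚ.≤-trans (degree-≤ graph x l (λ {y} e → sub (toAdj {x} {y} e))) le
  where
  open Representation R
  open TreeGraph tree
  lists : ∀ v → _
  lists v = path-list (S? v) (paths v)
  in-list : ∀ v x → S v x → x ∈ proj₁ (lists v)
  in-list v = proj₂ (proj₂ (proj₂ (lists v)))
  from-list : ∀ v x → x ∈ proj₁ (lists v) → S v x
  from-list v = proj₁ (proj₂ (proj₂ (lists v)))

module Transport {G : Graph} {A : Set} {m : ℕ} (R : Representation G A)
  (enc : A → Fin m) (dec : Fin m → A)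
  (dec-enc : ∀ a → dec (enc a) ≡ a) (enc-dec : ∀ i → enc (dec i) ≡ i) where
  open Representation R

  ≢dec : ∀ {i a} → i ≢ enc a → dec i ≢ a
  ≢dec ne refl = ne (sym (enc-dec _))

  enc-injective : ∀ {a b} → enc a ≡ enc b → a ≡ b
  enc-injective e = trans (sym (dec-enc _)) (trans (cong dec e) (dec-enc _))

  dec-injective : ∀ {i j} → dec i ≡ dec j → i ≡ j
  dec-injective e = trans (sym (enc-dec _)) (trans (cong enc e) (enc-dec _))

  transported : Representation G (Fin m)
  transported = record
    { tree = record
      { _≟_ = Finₚ._≟_ ; root = enc root ; parent = enc ∘ parent ∘ dec ; rank = rank ∘ dec
      ; parent-root = cong enc (trans (cong parent (dec-enc root)) parent-root)
      ; rank-parent = λ {i} ne → ℕₚ.≤-<-trans (ℕₚ.≤-reflexive (cong rank (dec-enc _))) (rank-parent (≢dec ne)) }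
    ; S = λ v → S v ∘ dec
    ; S? = λ v x → S? v (dec x)
    ; paths = λ v → let open PathSet (paths v) in record
      { top = enc top
      ; top∈ = subst (S v) (sym (dec-enc top)) top∈
      ; up = λ x∈ ne → let (nr , p∈) = up x∈ (≢dec ne) in
          (λ { refl → nr (dec-enc root) }) , subst (S v) (sym (dec-enc _)) p∈
      ; one = λ a∈ b∈ na nb e ne → dec-injective (one a∈ b∈ (≢dec na) (≢dec nb) (enc-injective e) (ne ∘ cong enc))
      ; two = λ a∈ b∈ c∈ na nb nc ea eb ec → reflect (two a∈ b∈ c∈ (≢dec na) (≢dec nb) (≢dec nc)
                (enc-injective ea) (enc-injective eb) (enc-injective ec)) }
    ; meet = λ u v u≢v → let open Equivalence (meet u v u≢v) in mk⇔
        (λ e → let x , xu , xv = to e in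
          enc x , subst (S u) (sym (dec-enc x)) xu , subst (S v) (sym (dec-enc x)) xv)
        (λ { (x , xu , xv) → from (dec x , xu , xv) }) }
    where
    reflect : ∀ {i j k} → dec i ≡ dec j ⊎ dec i ≡ dec k ⊎ dec j ≡ dec k → i ≡ j ⊎ i ≡ k ⊎ j ≡ k
    reflect (inj₁ e) = inj₁ (dec-injective e)
    reflect (inj₂ (inj₁ e)) = inj₂ (inj₁ (dec-injective e))
    reflect (inj₂ (inj₂ e)) = inj₂ (inj₂ (dec-injective e))

  child-dec : ∀ {i j} → Representation.Child transported i j → Child (dec i) (dec j)
  child-dec (nr , e) = (≢dec nr) , trans (sym (dec-enc _)) (cong dec e)

  adj-dec : ∀ {i j} → Representation.Adj transported i j → Adj (dec i) (dec j)
  adj-dec (inj₁ c) = inj₁ (child-dec c)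
  adj-dec (inj₂ c) = inj₂ (child-dec c)

-- Local changes of the host: splitting a vertex, contracting an edge

-- For each `q`, `col q` is a proper colouring of the link graph at `q`, expressed directly by the
-- paths.
TurnsProper : ∀ {G N h} → Representation G (Fin N) → (Fin N → Fin N → Fin h) → Set
TurnsProper {G} R col = let open Representation R in
  ∀ (v : Fin (n G)) {q y z} → S v q → S v y → S v z → Adj q y → Adj q z → y ≢ z → col q y ≢ col q z

-- Every vertex q of the host tree becomes a caterpillar with one chain of N + 1 vertices per
-- colour: the neighbour z of q is attached at position z of the chain of its colour. The chain
-- of the colour of the parent of q leads down from the parent to its last vertex, the centre
-- of q; the other chains start below the centre. A path running through q towards two
-- neighbours, which have different colours, then passes through the centre.
module Split {G : Graph} {N h : ℕ} (R : Representation G (Fin N)) (col : Fin N → Fin N → Fin h)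
  (proper : TurnsProper R col) where
  open Representation R

  Node : Set
  Node = Fin N × Fin h × Fin (suc N)

  -- The root is its own parent, so there this is just some colour; the chain of that colour begins
  -- at `root′`.
  up-col : Fin N → Fin h
  up-col q = col q (parent q)

  -- Slots occupy the positions `inject₁ z`, so the last of the `suc N` positions never carries a
  -- child and is free for the centre.
  centre slot : Fin N → Node
  centre q = q , up-col q , fromℕ N
  slot z = parent z , col (parent z) z , inject₁ z

  entry : ∀ q → Dec (q ≡ root) → Node
  entry q (yes _) = q , up-col q , zero
  entry q (no _)  = slot q

  base : ∀ q {c} → Dec (c ≡ up-col q) → Node
  base q (yes _) = entry q (q ≟ root)
  base q (no _)  = centre q

  par : Node → Node
  par (q , c , zero)  = base q (c Finₚ.≟ up-col q)
  par (q , c , suc k) = q , c , inject₁ k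

  root′ : Node
  root′ = root , up-col root , zero

  -- The parent function as a relation, so that its cases can be distinguished without repeating the
  -- decisions inside `par`.
  data Step : Node → Node → Set where
    chain  : ∀ {q c k} → Step (q , c , suc k) (q , c , inject₁ k)
    down   : ∀ {q c} → c ≢ up-col q → Step (q , c , zero) (centre q)
    across : ∀ {q} → q ≢ root → Step (q , up-col q , zero) (slot q)

  par-step : ∀ a → a ≢ root′ → Step a (par a)
  par-step (q , c , suc k) _ = chain
  par-step (q , c , zero) ne with c Finₚ.≟ up-col q
  ... | no c≢ = down c≢
  ... | yes refl with q ≟ root
  ...   | yes refl = ⊥-elim (ne refl)
  ...   | no q≢r = across q≢r

  step-par : ∀ {a x} → Step a x → par a ≡ x × a ≢ root′
  step-par chain = refl , λ ()
  step-par (down {q} {c} c≢) with c Finₚ.≟ up-col q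
  ... | yes e = ⊥-elim (c≢ e)
  ... | no _ = refl , λ { refl → c≢ refl }
  step-par (across {q} q≢r) with up-col q Finₚ.≟ up-col q
  ... | no ne = ⊥-elim (ne refl)
  ... | yes _ with q ≟ root
  ...   | yes e = ⊥-elim (q≢r e)
  ...   | no _ = refl , λ { refl → q≢r refl }

  width : ℕ
  width = suc N + suc N

  -- The other chains hang below the end of the up chain and so get the second half of the range.
  -- Every offset is below `width`, so moving to a slot at the parent of `q` lowers the rank
  -- whatever the offsets are.
  offset : ∀ q {c} → Dec (c ≡ up-col q) → Fin (suc N) → ℕ
  offset q (yes _) k = toℕ k
  offset q (no _)  k = suc N + toℕ k

  offset-< : ∀ q {c} (d : Dec (c ≡ up-col q)) k → offset q d k < width
  offset-< q (yes _) k = ℕₚ.<-≤-trans (Finₚ.toℕ<n k) (ℕₚ.m≤m+n (suc N) (suc N))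
  offset-< q (no _)  k = ℕₚ.+-monoʳ-< (suc N) (Finₚ.toℕ<n k)

  rank′ : Node → ℕ
  rank′ (q , c , k) = rank q * width + offset q (c Finₚ.≟ up-col q) k

  step-rank : ∀ {a x} → Step a x → rank′ x < rank′ a
  step-rank (chain {q} {c} {k}) = ℕₚ.+-monoʳ-< (rank q * width) (lemma (c Finₚ.≟ up-col q))
    where
    lemma : (d : Dec (c ≡ up-col q)) → offset q d (inject₁ k) < offset q d (suc k)
    lemma (yes _) = s≤s (ℕₚ.≤-reflexive (Finₚ.toℕ-inject₁ k))
    lemma (no _)  = ℕₚ.+-monoʳ-< (suc N) (s≤s (ℕₚ.≤-reflexive (Finₚ.toℕ-inject₁ k)))
  step-rank (down {q} {c} c≢) = ℕₚ.+-monoʳ-< (rank q * width) (lemma (up-col q Finₚ.≟ up-col q) (c Finₚ.≟ up-col q))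
    where
    lemma : (d : Dec (up-col q ≡ up-col q)) (d′ : Dec (c ≡ up-col q)) → offset q d (fromℕ N) < offset q d′ zero
    lemma _       (yes e) = ⊥-elim (c≢ e)
    lemma (no ne) _       = ⊥-elim (ne refl)
    lemma (yes _) (no _)  = ℕₚ.<-≤-trans (Finₚ.toℕ<n (fromℕ N)) (ℕₚ.m≤m+n (suc N) 0)
  step-rank (across {q} q≢r) = ℕₚ.<-≤-trans
    (ℕₚ.+-monoʳ-< (rank (parent q) * width) (offset-< (parent q) (col (parent q) q Finₚ.≟ up-col (parent q)) (inject₁ q)))
    (ℕₚ.≤-trans (ℕₚ.≤-reflexive (ℕₚ.+-comm (rank (parent q) * width) width))
      (ℕₚ.≤-trans (ℕₚ.*-monoˡ-≤ width (rank-parent q≢r)) (ℕₚ.m≤m+n (rank q * width) _)))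

  split-tree : RootedTree Node
  split-tree = record
    { _≟_ = ≡-dec Finₚ._≟_ (≡-dec Finₚ._≟_ Finₚ._≟_)
    ; root = root′ ; parent = par ; rank = rank′
    ; parent-root = parent-root′
    ; rank-parent = λ {a} ne → step-rank (par-step a ne) }
    where
    parent-root′ : par root′ ≡ root′
    parent-root′ with up-col root Finₚ.≟ up-col root
    ... | no ne = ⊥-elim (ne refl)
    ... | yes _ with root ≟ root
    ...   | yes _ = refl
    ...   | no ne = ⊥-elim (ne refl)

  module _ (v : Fin (n G)) where
    open PathSet (paths v)

    Branch : Fin N → Fin h → Fin N → Set
    Branch q c z = S v z × Child z q × col q z ≡ c

    Branch? : ∀ q c z → Dec (Branch q c z)
    Branch? q c z = S? v z ×-dec Child? z q ×-dec (col q z Finₚ.≟ c)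

    -- A path that comes from the parent of `q` uses the whole up chain. At the top of the path only
    -- the stretch from the slot of a child coloured `up-col q`, if there is one, to the centre is
    -- used. Any other chain is used from its start to the slot of the child it leads to. In all
    -- cases the centre belongs to the path.
    Member : Node → Set
    Member (q , c , k) = S v q ×
      ((c ≡ up-col q × (q ≢ top ⊎ k ≡ fromℕ N ⊎ ∃ λ z → Branch q c z × toℕ z ≤ toℕ k)) ⊎
       (c ≢ up-col q × ∃ λ z → Branch q c z × toℕ k ≤ toℕ z))

    Member? : ∀ a → Dec (Member a)
    Member? (q , c , k) = S? v q ×-dec
      (((c Finₚ.≟ up-col q) ×-dec (¬? (q ≟ top) ⊎-dec (k Finₚ.≟ fromℕ N) ⊎-dec
          any? λ z → Branch? q c z ×-dec (toℕ z ℕ.≤? toℕ k))) ⊎-dec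
       (¬? (c Finₚ.≟ up-col q) ×-dec any? λ z → Branch? q c z ×-dec (toℕ k ℕ.≤? toℕ z)))

    branch-unique : ∀ {q c z z′} → S v q → Branch q c z → Branch q c z′ → z ≡ z′
    branch-unique {z = z} {z′} q∈ (z∈ , zq , e) (z′∈ , z′q , e′) with z ≟ z′
    ... | yes eq = eq
    ... | no ne = ⊥-elim (proper v q∈ z∈ z′∈ (inj₂ zq) (inj₂ z′q) ne (trans e (sym e′)))

    no-up-branch : ∀ {q z} → S v q → q ≢ top → ¬ Branch q (up-col q) z
    no-up-branch {q} {z} q∈ q≢t (z∈ , zq , e) = let (nr , p∈) = up q∈ q≢t in
      proper v q∈ p∈ z∈ (inj₁ (nr , refl)) (inj₂ zq)
        (λ { refl → ℕₚ.<-asym (rank-parent nr) (child-< zq) }) (sym e)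

    -- A child with the colour of the parent hangs on the up chain, above the centre, so its slot is
    -- the highest node of the new path.
    top-at : Dec (∃ (Branch top (up-col top))) → Node
    top-at (yes (z , _)) = top , up-col top , inject₁ z
    top-at (no _)        = centre top

    top′ : Node
    top′ = top-at (any? (Branch? top (up-col top)))

    top-cases : (∃ λ z → Branch top (up-col top) z × top′ ≡ (top , up-col top , inject₁ z)) ⊎
                top′ ≡ centre top
    top-cases with any? (Branch? top (up-col top))
    ... | yes (z , b) = inj₁ (z , b , refl)
    ... | no _        = inj₂ refl

    top-slot : ∀ {z} → Branch top (up-col top) z → top′ ≡ (top , up-col top , inject₁ z)
    top-slot {z} b with any? (Branch? top (up-col top))
    ... | yes (z′ , b′) = cong (λ y → top , up-col top , inject₁ y) (branch-unique top∈ b′ b)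
    ... | no none       = ⊥-elim (none (z , b))

    top-slot′ : ∀ {q z} → q ≡ top → Branch q (up-col q) z → top′ ≡ (q , up-col q , inject₁ z)
    top-slot′ refl = top-slot

    top′∈ : Member top′
    top′∈ with any? (Branch? top (up-col top))
    ... | yes (z , b) = top∈ , inj₁ (refl , inj₂ (inj₂ (z , b , ℕₚ.≤-reflexive (sym (Finₚ.toℕ-inject₁ z)))))
    ... | no _        = top∈ , inj₁ (refl , inj₂ (inj₁ refl))

    centre∈ : ∀ {q} → S v q → Member (centre q)
    centre∈ q∈ = q∈ , inj₁ (refl , inj₂ (inj₁ refl))

    slot∈ : ∀ {q} → S v q → q ≢ root → S v (parent q) → Member (slot q)
    slot∈ {q} q∈ q≢r p∈ with col (parent q) q Finₚ.≟ up-col (parent q)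
    ... | yes e = p∈ , inj₁ (e , inj₂ (inj₂ (q , (q∈ , (q≢r , refl) , refl) , ℕₚ.≤-reflexive (sym (Finₚ.toℕ-inject₁ q)))))
    ... | no ne = p∈ , inj₂ (ne , q , (q∈ , (q≢r , refl) , refl) , ℕₚ.≤-reflexive (Finₚ.toℕ-inject₁ q))

    -- Steps together with the reason why they stay on the path of `v`; these witnesses turn a
    -- coincidence of nodes into a statement about children of `q`.
    data MemberStep : Node → Node → Set where
      chain  : ∀ {q c k} → Member (q , c , suc k) → MemberStep (q , c , suc k) (q , c , inject₁ k)
      down   : ∀ {q c z} → S v q → c ≢ up-col q → Branch q c z → MemberStep (q , c , zero) (centre q)
      across : ∀ {q} → S v q → S v (parent q) → q ≢ root → MemberStep (q , up-col q , zero) (slot q)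

    ascend : ∀ a → Member a → a ≢ top′ → ∃ λ x → Step a x × MemberStep a x × Member x
    ascend (q , c , suc k) a∈@(q∈ , inj₂ (c≢ , z , b , k<z)) _ =
      _ , chain , chain a∈ , q∈ , inj₂ (c≢ , z , b ,
        ℕₚ.≤-trans (ℕₚ.≤-reflexive (Finₚ.toℕ-inject₁ k)) (ℕₚ.<⇒≤ k<z))
    ascend (q , c , suc k) a∈@(q∈ , inj₁ (refl , why)) a≢t = _ , chain , chain a∈ , q∈ , inj₁ (refl , lower (q ≟ top) why)
      where
      lower : Dec (q ≡ top) → q ≢ top ⊎ suc k ≡ fromℕ N ⊎ (∃ λ z → Branch q (up-col q) z × toℕ z ≤ suc (toℕ k)) →
              q ≢ top ⊎ inject₁ k ≡ fromℕ N ⊎ (∃ λ z → Branch q (up-col q) z × toℕ z ≤ toℕ (inject₁ k))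
      lower (no q≢t) _ = inj₁ q≢t
      lower (yes refl) (inj₁ ne) = ⊥-elim (ne refl)
      -- Here the node is the centre. As it is not `top′`, the latter is a slot at some `z`, and
      -- `toℕ z` is less than N, the successor of `toℕ k`.
      lower (yes refl) (inj₂ (inj₁ e)) with top-cases
      ... | inj₂ t≡ = ⊥-elim (a≢t (trans (cong (λ i → q , up-col q , i) e) (sym t≡)))
      ... | inj₁ (z , b , _) = inj₂ (inj₂ (z , b , subst (toℕ z ≤_) (sym (Finₚ.toℕ-inject₁ k))
              (ℕₚ.≤-pred (subst (toℕ z <_) (sym (trans (cong toℕ e) (Finₚ.toℕ-fromℕ N))) (Finₚ.toℕ<n z)))))
      lower (yes refl) (inj₂ (inj₂ (z , b , z≤))) with ℕₚ.m≤n⇒m<n∨m≡n z≤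
      ... | inj₁ (s≤s z≤k) = inj₂ (inj₂ (z , b , subst (toℕ z ≤_) (sym (Finₚ.toℕ-inject₁ k)) z≤k))
      ... | inj₂ e = ⊥-elim (a≢t (trans (cong (λ i → q , up-col q , i)
              (Finₚ.toℕ-injective (trans (sym e) (sym (Finₚ.toℕ-inject₁ z))))) (sym (top-slot b))))
    ascend (q , c , zero) (q∈ , inj₂ (c≢ , z , b , _)) _ = _ , down c≢ , down q∈ c≢ b , centre∈ q∈
    ascend (q , c , zero) (q∈ , inj₁ (refl , why)) a≢t with q ≟ top
    ... | no q≢t = let (nr , p∈) = up q∈ q≢t in _ , across nr , across q∈ p∈ nr , slot∈ q∈ nr p∈
    ... | yes refl = ⊥-elim (impossible why)
      where
      impossible : ¬ (q ≢ top ⊎ zero ≡ fromℕ N ⊎ ∃ λ z → Branch q (up-col q) z × toℕ z ≤ 0)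
      impossible (inj₁ ne) = ne refl
      -- The first position could be the last only for N = 0, but `q : Fin N`.
      impossible (inj₂ (inj₁ e)) =
        ℕₚ.n≮0 (subst (toℕ q <_) (sym (trans (cong toℕ e) (Finₚ.toℕ-fromℕ N))) (Finₚ.toℕ<n q))
      impossible (inj₂ (inj₂ (z , b , z≤0))) = a≢t (trans (cong (λ i → q , up-col q , i)
        (Finₚ.toℕ-injective {i = zero} (trans (sym (ℕₚ.n≤0⇒n≡0 z≤0)) (sym (Finₚ.toℕ-inject₁ z))))) (sym (top-slot b)))

    branch≢top : ∀ {q c z} → S v q → Branch q c z → z ≢ top
    branch≢top q∈ (_ , zq , _) = child≢top q∈ zq

    same-colour : ∀ {q c c′ z z′} → Branch q c z → Branch q c′ z′ → z ≡ z′ → c ≡ c′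
    same-colour (_ , _ , e) (_ , _ , e′) refl = trans (sym e) e′

    -- Off the up chain, the path ends its stretch at the slot of its only child of that colour. On
    -- the up chain, such a child exists only where `q` is the top, and then its slot is `top′`.
    chain-across : ∀ {q c k z} → Member (q , c , suc k) → S v z → z ≢ root →
                   (q , c , inject₁ k) ≡ slot z → (q , c , inject₁ k) ≡ top′
    chain-across {q} {c} {k} {z} (q∈ , why) z∈ z≢r e
      with ,-injectiveˡ e | Finₚ.inject₁-injective (,-injectiveʳ (,-injectiveʳ e))
    ... | refl | refl with ,-injectiveˡ (,-injectiveʳ e)
    ...   | refl with why
    ...     | inj₂ (_ , z′ , b , z<z′) =
              ⊥-elim (ℕₚ.<-irrefl (cong toℕ (branch-unique q∈ (z∈ , (z≢r , refl) , refl) b)) z<z′)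
    ...     | inj₁ (c≡ , _) with parent z ≟ top
    ...       | no q≢t = ⊥-elim (no-up-branch q∈ q≢t (z∈ , (z≢r , refl) , c≡))
    ...       | yes q≡t = trans (cong (λ c → parent z , c , inject₁ z) c≡)
                                (sym (top-slot′ q≡t (z∈ , (z≢r , refl) , c≡)))

    chain-unique : ∀ {q c q′ c′} {k k′ : Fin N} →
      _≡_ {A = Node} (q , c , inject₁ k) (q′ , c′ , inject₁ k′) → _≡_ {A = Node} (q , c , suc k) (q′ , c′ , suc k′)
    chain-unique e with ,-injectiveˡ e | ,-injectiveˡ (,-injectiveʳ e) | Finₚ.inject₁-injective (,-injectiveʳ (,-injectiveʳ e))
    ... | refl | refl | refl = refl

    slot-unique : ∀ {q q′} → slot q ≡ slot q′ → q ≡ q′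
    slot-unique e = Finₚ.inject₁-injective (,-injectiveʳ (,-injectiveʳ e))

    centre≢ : ∀ {q q′ c} {k : Fin N} → _≢_ {A = Node} (centre q) (q′ , c , inject₁ k)
    centre≢ e = Finₚ.fromℕ≢inject₁ (,-injectiveʳ (,-injectiveʳ e))

    -- Only `down` ends at a last position, so it clashes with no other step, and `chain` clashes
    -- with `across` only at `top′`. Two `down` steps into one centre come from two children of `q`
    -- on the path, which coincide unless `q` is the top.
    one′ : ∀ {a b x y} → MemberStep a x → MemberStep b y → x ≡ y → x ≢ top′ → a ≡ b
    one′ (chain _) (chain _) e _ = chain-unique e
    one′ (chain m) (across z∈ _ z≢r) e ne = ⊥-elim (ne (chain-across m z∈ z≢r e))
    one′ (across z∈ _ z≢r) (chain m) e ne = ⊥-elim (ne (trans e (chain-across m z∈ z≢r (sym e))))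
    one′ (across _ _ _) (across _ _ _) e _ = cong (λ q → q , up-col q , zero) (slot-unique e)
    one′ (chain _) (down _ _ _) e _ = ⊥-elim (centre≢ (sym e))
    one′ (down _ _ _) (chain _) e _ = ⊥-elim (centre≢ e)
    one′ (across _ _ _) (down _ _ _) e _ = ⊥-elim (centre≢ (sym e))
    one′ (down _ _ _) (across _ _ _) e _ = ⊥-elim (centre≢ e)
    one′ (down {q} q∈ c≢ b@(z∈ , zq , _)) (down _ _ b′@(z′∈ , z′q , _)) e ne with ,-injectiveˡ e
    ... | refl with q ≟ top
    ...   | no q≢t = cong (λ c → q , c , zero) (same-colour b b′
              (one z∈ z′∈ (branch≢top q∈ b) (branch≢top q∈ b′) (trans (proj₂ zq) (sym (proj₂ z′q)))
                   (λ e′ → q≢t (trans (sym (proj₂ zq)) e′))))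
    one′ (down q∈ c≢ b@(z∈ , zq , _)) (down _ c′≢ b′@(z′∈ , z′q , _)) e ne | refl | yes refl with top-cases
    ... | inj₂ t≡ = ⊥-elim (ne (sym t≡))
    -- Now `top′` is the slot of a third child `z₀`, coloured `up-col top`. Two of the three
    -- children coincide, and `z₀` has a colour different from both others.
    ... | inj₁ (z₀ , b₀@(z₀∈ , z₀q , _) , _)
      with two z₀∈ z∈ z′∈ (branch≢top q∈ b₀) (branch≢top q∈ b) (branch≢top q∈ b′) (proj₂ z₀q) (proj₂ zq) (proj₂ z′q)
    ...   | inj₁ e₁ = ⊥-elim (c≢ (same-colour b b₀ (sym e₁)))
    ...   | inj₂ (inj₁ e₁) = ⊥-elim (c′≢ (same-colour b′ b₀ (sym e₁)))
    ...   | inj₂ (inj₂ e₁) = cong (λ c → top , c , zero) (same-colour b b′ e₁)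

    -- If `top′` is a slot, at most one `chain` and one `across` step end there. If it is a centre,
    -- only `down` steps do, and `two` limits the children they lead to.
    two′ : ∀ {a b c x y z} → MemberStep a x → MemberStep b y → MemberStep c z →
           x ≡ top′ → y ≡ top′ → z ≡ top′ → a ≡ b ⊎ a ≡ c ⊎ b ≡ c
    two′ (down _ _ _) (chain _) _ e e′ _ = ⊥-elim (centre≢ (trans e (sym e′)))
    two′ (down _ _ _) (across _ _ _) _ e e′ _ = ⊥-elim (centre≢ (trans e (sym e′)))
    two′ (down _ _ _) _ (chain _) e _ e′ = ⊥-elim (centre≢ (trans e (sym e′)))
    two′ (down _ _ _) _ (across _ _ _) e _ e′ = ⊥-elim (centre≢ (trans e (sym e′)))
    two′ (chain _) (down _ _ _) _ e e′ _ = ⊥-elim (centre≢ (trans e′ (sym e)))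
    two′ (across _ _ _) (down _ _ _) _ e e′ _ = ⊥-elim (centre≢ (trans e′ (sym e)))
    two′ (chain _) _ (down _ _ _) e _ e′ = ⊥-elim (centre≢ (trans e′ (sym e)))
    two′ (across _ _ _) _ (down _ _ _) e _ e′ = ⊥-elim (centre≢ (trans e′ (sym e)))
    two′ (chain _) (chain _) _ e e′ _ = inj₁ (chain-unique (trans e (sym e′)))
    two′ (chain _) (across _ _ _) (chain _) e _ e′ = inj₂ (inj₁ (chain-unique (trans e (sym e′))))
    two′ (across _ _ _) (chain _) (chain _) _ e e′ = inj₂ (inj₂ (chain-unique (trans e (sym e′))))
    two′ (across _ _ _) (across _ _ _) _ e e′ _ =
      inj₁ (cong (λ q → q , up-col q , zero) (slot-unique (trans e (sym e′))))
    two′ (across _ _ _) (chain _) (across _ _ _) e _ e′ =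
      inj₂ (inj₁ (cong (λ q → q , up-col q , zero) (slot-unique (trans e (sym e′)))))
    two′ (chain _) (across _ _ _) (across _ _ _) _ e e′ =
      inj₂ (inj₂ (cong (λ q → q , up-col q , zero) (slot-unique (trans e (sym e′)))))
    two′ (down q∈ _ b₁@(z₁∈ , z₁q , _)) (down _ _ b₂@(z₂∈ , z₂q , _)) (down _ _ b₃@(z₃∈ , z₃q , _)) e₁ e₂ e₃
      with ,-injectiveˡ (trans e₁ (sym e₂)) | ,-injectiveˡ (trans e₁ (sym e₃))
    ... | refl | refl with trans (,-injectiveˡ e₁) top-first
      where
      top-first : proj₁ top′ ≡ top
      top-first with top-cases
      ... | inj₁ (_ , _ , t≡) = cong proj₁ t≡
      ... | inj₂ t≡ = cong proj₁ t≡
    ...   | refl with two z₁∈ z₂∈ z₃∈ (branch≢top q∈ b₁) (branch≢top q∈ b₂) (branch≢top q∈ b₃)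
                          (proj₂ z₁q) (proj₂ z₂q) (proj₂ z₃q)
    ...     | inj₁ e = inj₁ (cong (λ c → top , c , zero) (same-colour b₁ b₂ e))
    ...     | inj₂ (inj₁ e) = inj₂ (inj₁ (cong (λ c → top , c , zero) (same-colour b₁ b₃ e)))
    ...     | inj₂ (inj₂ e) = inj₂ (inj₂ (cong (λ c → top , c , zero) (same-colour b₂ b₃ e)))

    ascend-par : ∀ {a} → Member a → a ≢ top′ → MemberStep a (par a) × a ≢ root′ × Member (par a)
    ascend-par {a} a∈ ne with ascend a a∈ ne
    ... | x , st , ms , x∈ with step-par st
    ...   | refl , nr = ms , nr , x∈

    member-path : PathSet split-tree Member
    member-path = record
      { top = top′ ; top∈ = top′∈
      ; up = λ a∈ ne → proj₂ (ascend-par a∈ ne)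
      ; one = λ a∈ b∈ na nb e ne → one′ (proj₁ (ascend-par a∈ na)) (proj₁ (ascend-par b∈ nb)) e ne
      ; two = λ a∈ b∈ c∈ na nb nc ea eb ec → two′ (proj₁ (ascend-par a∈ na))
                (proj₁ (ascend-par b∈ nb)) (proj₁ (ascend-par c∈ nc)) ea eb ec }

  split : Representation G Node
  split = record
    { tree = split-tree ; S = Member ; S? = Member? ; paths = member-path
    ; meet = λ u v u≢v → let open Equivalence (meet u v u≢v) in mk⇔
        (λ e → let x , xu , xv = to e in centre x , centre∈ u xu , centre∈ v xv)
        (λ { ((q , _) , (qu , _) , (qv , _)) → from (q , qu , qv) }) }

  child-step : ∀ {a x} → RootedTree.Child split-tree a x → Step a x
  child-step {a} (ne , refl) = par-step a ne

  -- Before the last position a node has its parent, its successor on the chain and at most the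
  -- entry of the child whose slot it is. At the last position there is at most one neighbour per
  -- colour, with the parent standing for `up-col q`.
  few-neighbours : 3 ≤ h → ∀ x → ∃ λ l → (∀ {y} → RootedTree.Adj split-tree x y → y ∈ l) × length l ≤ h
  few-neighbours 3≤h x@(q , c , k) with view k
  ... | ‵inject₁ j = par x ∷ (q , c , suc j) ∷ (j , up-col j , zero) ∷ [] , sub , 3≤h
    where
    below : ∀ {y x′} → Step y x′ → x′ ≡ (q , c , inject₁ j) → y ∈ (par x ∷ (q , c , suc j) ∷ (j , up-col j , zero) ∷ [])
    below chain e with ,-injectiveˡ e | ,-injectiveˡ (,-injectiveʳ e) | Finₚ.inject₁-injective (,-injectiveʳ (,-injectiveʳ e))
    ... | refl | refl | refl = there (here refl)
    below (down _) e = ⊥-elim (Finₚ.fromℕ≢inject₁ (,-injectiveʳ (,-injectiveʳ e)))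
    below (across _) e with Finₚ.inject₁-injective (,-injectiveʳ (,-injectiveʳ e))
    ... | refl = there (there (here refl))
    sub : ∀ {y} → RootedTree.Adj split-tree x y → y ∈ _
    sub (inj₁ (_ , refl)) = here refl
    sub (inj₂ ch) = below (child-step ch) refl
  ... | ‵fromℕ = map nbr (allFin h) , sub
      , ℕₚ.≤-reflexive (trans (length-map nbr (allFin h)) (length-tabulate {n = h} (λ i → i)))
    where
    nbr : Fin h → Node
    nbr c′ with c′ Finₚ.≟ up-col q
    ... | yes _ = par x
    ... | no _  = q , c′ , zero
    nbr-up : nbr (up-col q) ≡ par x
    nbr-up with up-col q Finₚ.≟ up-col q
    ... | yes _ = refl
    ... | no ne = ⊥-elim (ne refl)
    nbr-down : ∀ {c′} → c′ ≢ up-col q → nbr c′ ≡ (q , c′ , zero)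
    nbr-down {c′} ne with c′ Finₚ.≟ up-col q
    ... | yes e = ⊥-elim (ne e)
    ... | no _ = refl
    below : ∀ {y x′} → Step y x′ → x′ ≡ x → y ∈ map nbr (allFin h)
    below chain e = ⊥-elim (Finₚ.fromℕ≢inject₁ (sym (,-injectiveʳ (,-injectiveʳ e))))
    below (across _) e = ⊥-elim (Finₚ.fromℕ≢inject₁ (sym (,-injectiveʳ (,-injectiveʳ e))))
    below (down {c = c′} c≢) e with ,-injectiveˡ e
    ... | refl = subst (_∈ map nbr (allFin h)) (nbr-down c≢) (∈-map⁺ nbr (∈-allFin c′))
    sub : ∀ {y} → RootedTree.Adj split-tree x y → y ∈ map nbr (allFin h)
    sub (inj₁ (_ , refl)) = subst (_∈ map nbr (allFin h)) nbr-up (∈-map⁺ nbr (∈-allFin (up-col q)))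
    sub (inj₂ ch) = below (child-step ch) refl

  bounded : 3 ≤ h → In[ h ,2,1] G
  bounded 3≤h = toIn transported λ x → let l , sub , le = few-neighbours 3≤h (dec x) in
      map enc l
    , (λ {y} xy → subst (_∈ map enc l) (enc-dec y) (∈-map⁺ enc (sub (adj-dec xy))))
    , subst (_≤ h) (sym (length-map enc l)) le
    where
    enc : Node → Fin (N * (h * suc N))
    enc (q , c , k) = combine q (combine c k)
    dec : Fin (N * (h * suc N)) → Node
    dec i = let (q , j) = remQuot (h * suc N) i in q , remQuot (suc N) j
    dec-enc : ∀ a → dec (enc a) ≡ a
    dec-enc (q , c , k) = trans
      (cong (λ p → proj₁ p , remQuot {h} (suc N) (proj₂ p)) (Finₚ.remQuot-combine {N} {h * suc N} q (combine c k)))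
      (cong (q ,_) (Finₚ.remQuot-combine {h} {suc N} c k))
    enc-dec : ∀ i → enc (dec i) ≡ i
    enc-dec i = let (q , j) = remQuot {N} (h * suc N) i in
      trans (cong (combine q) (Finₚ.combine-remQuot {h} (suc N) j)) (Finₚ.combine-remQuot {N} (h * suc N) i)
    open Transport split enc dec dec-enc enc-dec

-- The edge between x and its parent w is contracted to w; x stays behind as an unused leaf.
module Contract {G : Graph} {A : Set} (R : Representation G A) (x : A) (x≢root : x ≢ Representation.root R) where
  open Representation R

  w : A
  w = parent x

  w<x : rank w < rank x
  w<x = rank-parent x≢root

  w≢x : w ≢ x
  w≢x e = ℕₚ.<-irrefl (cong rank e) w<x

  shift : ∀ y → Dec (parent y ≡ x) → A
  shift y (yes _) = w
  shift y (no _)  = parent y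

  par : A → A
  par y = shift y (parent y ≟ x)

  par-cases : ∀ y → (parent y ≡ x × par y ≡ w) ⊎ (parent y ≢ x × par y ≡ parent y)
  par-cases y with parent y ≟ x
  ... | yes e = inj₁ (e , refl)
  ... | no ne = inj₂ (ne , refl)

  par-rank : ∀ {y} → y ≢ root → rank (par y) < rank y
  par-rank {y} y≢r with par-cases y
  ... | inj₂ (_ , e)  = subst (λ z → rank z < rank y) (sym e) (rank-parent y≢r)
  ... | inj₁ (e , e′) = subst (λ z → rank z < rank y) (sym e′)
    (ℕₚ.<-trans w<x (subst (λ z → rank z < rank y) e (rank-parent y≢r)))

  contracted-tree : RootedTree A
  contracted-tree = record
    { _≟_ = _≟_ ; root = root ; parent = par ; rank = rank
    ; parent-root = par-root ; rank-parent = par-rank }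
    where
    par-root : par root ≡ root
    par-root with par-cases root
    ... | inj₁ (e , _) = ⊥-elim (x≢root (trans (sym e) parent-root))
    ... | inj₂ (_ , e) = trans e parent-root

  module _ (v : Fin (n G)) where
    open PathSet (paths v)

    Merged : A → Set
    Merged y = (y ≡ w × (S v x ⊎ S v w)) ⊎ (y ≢ x × y ≢ w × S v y)

    Merged? : ∀ y → Dec (Merged y)
    Merged? y = ((y ≟ w) ×-dec (S? v x ⊎-dec S? v w)) ⊎-dec (¬? (y ≟ x) ×-dec ¬? (y ≟ w) ×-dec S? v y)

    merge : ∀ {y} → S v y → y ≢ x → Merged y
    merge {y} y∈ y≢x with y ≟ w
    ... | yes refl = inj₁ (refl , inj₂ y∈)
    ... | no y≢w   = inj₂ (y≢x , y≢w , y∈)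

    top-at : Dec (top ≡ x) → A
    top-at (yes _) = w
    top-at (no _)  = top

    top′ : A
    top′ = top-at (top ≟ x)

    top-cases : (top ≡ x × top′ ≡ w) ⊎ (top ≢ x × top′ ≡ top)
    top-cases with top ≟ x
    ... | yes e = inj₁ (e , refl)
    ... | no ne = inj₂ (ne , refl)

    top′∈ : Merged top′
    top′∈ with top-cases
    ... | inj₁ (refl , e) = subst Merged (sym e) (inj₁ (refl , inj₁ top∈))
    ... | inj₂ (ne , e)   = subst Merged (sym e) (merge top∈ ne)

    -- Only `w` could be new on the path, by way of `x`. If `x` was the top, then `w` is the new
    -- top; otherwise `w`, being the parent of `x`, was on the path already.
    original : ∀ {y} → Merged y → y ≢ top′ → S v y × y ≢ top × y ≢ x
    original m ne with top-cases
    original (inj₁ (refl , _)) ne | inj₁ (_ , e) = ⊥-elim (ne (sym e))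
    original (inj₁ (refl , inj₁ x∈)) ne | inj₂ (t≢x , e) =
      proj₂ (up x∈ (≢-sym t≢x)) , (λ w≡t → ne (trans w≡t (sym e))) , w≢x
    original (inj₁ (refl , inj₂ w∈)) ne | inj₂ (_ , e) = w∈ , (λ w≡t → ne (trans w≡t (sym e))) , w≢x
    original (inj₂ (y≢x , _ , y∈)) ne | inj₁ (t≡x , _) = y∈ , (λ y≡t → y≢x (trans y≡t t≡x)) , y≢x
    original (inj₂ (y≢x , _ , y∈)) ne | inj₂ (_ , e) = y∈ , (λ y≡t → ne (trans y≡t (sym e))) , y≢x

    up′ : ∀ {y} → Merged y → y ≢ top′ → y ≢ root × Merged (par y)
    up′ {y} m ne with original m ne
    ... | y∈ , y≢t , _ with up y∈ y≢t | par-cases y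
    ...   | y≢r , p∈ | inj₂ (p≢x , e) = y≢r , subst Merged (sym e) (merge p∈ p≢x)
    ...   | y≢r , p∈ | inj₁ (p≡x , e) = y≢r , subst Merged (sym e) (inj₁ (refl , inj₁ (subst (S v) p≡x p∈)))

    w∉ : top ≡ x → ¬ S v w
    w∉ refl w∈ = ℕₚ.<⇒≱ w<x (top-min w∈)

    one′ : ∀ {a b} → Merged a → Merged b → a ≢ top′ → b ≢ top′ → par a ≡ par b → par a ≢ top′ → a ≡ b
    one′ {a} {b} ma mb na nb e ne with original ma na | original mb nb | par-cases a | par-cases b | top-cases
    ... | a∈ , a≢t , a≢x | b∈ , b≢t , b≢x | inj₁ (pa , ea) | inj₁ (pb , eb) | inj₁ (_ , et) =
      ⊥-elim (ne (trans ea (sym et)))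
    ... | a∈ , a≢t , a≢x | b∈ , b≢t , b≢x | inj₁ (pa , ea) | inj₁ (pb , eb) | inj₂ (t≢x , _) =
      one a∈ b∈ a≢t b≢t (trans pa (sym pb)) (λ e′ → t≢x (trans (sym e′) pa))
    ... | a∈ , a≢t , a≢x | b∈ , b≢t , b≢x | inj₂ (pa , ea) | inj₂ (pb , eb) | tc =
      one a∈ b∈ a≢t b≢t (trans (sym ea) (trans e eb)) (not-top tc)
      where
      not-top : (top ≡ x × top′ ≡ w) ⊎ (top ≢ x × top′ ≡ top) → parent a ≢ top
      not-top (inj₁ (t≡x , _)) e′ = pa (trans e′ t≡x)
      not-top (inj₂ (_ , et)) e′ = ne (trans ea (trans e′ (sym et)))
    ... | a∈ , a≢t , a≢x | b∈ , b≢t , b≢x | inj₁ (pa , ea) | inj₂ (pb , eb) | inj₁ (_ , et) =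
      ⊥-elim (ne (trans ea (sym et)))
    -- With `a` below `x` and `b` below `w`, both `x` and `b` are children of `w` on the path,
    -- although `w` is not the top.
    ... | a∈ , a≢t , a≢x | b∈ , b≢t , b≢x | inj₁ (pa , ea) | inj₂ (pb , eb) | inj₂ (t≢x , et) =
      ⊥-elim (b≢x (sym (one (subst (S v) pa (proj₂ (up a∈ a≢t))) b∈ (≢-sym t≢x) b≢t
        (trans (sym ea) (trans e eb)) (λ w≡t → ne (trans ea (trans w≡t (sym et)))))))
    ... | a∈ , a≢t , a≢x | b∈ , b≢t , b≢x | inj₂ (pa , ea) | inj₁ (pb , eb) | inj₁ (_ , et) =
      ⊥-elim (ne (trans e (trans eb (sym et))))
    ... | a∈ , a≢t , a≢x | b∈ , b≢t , b≢x | inj₂ (pa , ea) | inj₁ (pb , eb) | inj₂ (t≢x , et) =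
      ⊥-elim (a≢x (sym (one (subst (S v) pb (proj₂ (up b∈ b≢t))) a∈ (≢-sym t≢x) a≢t
        (trans (sym eb) (trans (sym e) ea)) (λ w≡t → ne (trans e (trans eb (trans w≡t (sym et))))))))

    -- If `x` was the top, then `w` is off the path and all three are children of `x`. Otherwise `x`
    -- has only one child on the path, and when it has one, `x` already took one of the two places
    -- below the top `w`.
    two′ : ∀ {a b c} → Merged a → Merged b → Merged c → a ≢ top′ → b ≢ top′ → c ≢ top′ →
           par a ≡ top′ → par b ≡ top′ → par c ≡ top′ → a ≡ b ⊎ a ≡ c ⊎ b ≡ c
    two′ {a} {b} {c} ma mb mc na nb nc ea eb ec
      with original ma na | original mb nb | original mc nc | top-cases
    ... | a∈ , a≢t , a≢x | b∈ , b≢t , b≢x | c∈ , c≢t , c≢x | inj₁ (t≡x , et) =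
      two a∈ b∈ c∈ a≢t b≢t c≢t (all-shifted a∈ a≢t ea) (all-shifted b∈ b≢t eb) (all-shifted c∈ c≢t ec)
      where
      all-shifted : ∀ {y} → S v y → y ≢ top → par y ≡ top′ → parent y ≡ top
      all-shifted {y} y∈ y≢t e with par-cases y
      ... | inj₁ (e′ , _) = trans e′ (sym t≡x)
      ... | inj₂ (_ , e′) = ⊥-elim (w∉ t≡x (subst (S v) (trans (sym e′) (trans e et)) (proj₂ (up y∈ y≢t))))
    ... | a∈ , a≢t , a≢x | b∈ , b≢t , b≢x | c∈ , c≢t , c≢x | inj₂ (t≢x , et) =
      triple (kind a∈ a≢t ea) (kind b∈ b≢t eb) (kind c∈ c≢t ec)
      where
      Kind : A → Set
      Kind y = (parent y ≡ x × S v x × w ≡ top) ⊎ parent y ≡ top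
      kind : ∀ {y} → S v y → y ≢ top → par y ≡ top′ → Kind y
      kind {y} y∈ y≢t e with par-cases y
      ... | inj₁ (e′ , ew) = inj₁ (e′ , subst (S v) e′ (proj₂ (up y∈ y≢t)) , trans (sym ew) (trans e et))
      ... | inj₂ (_ , e′) = inj₂ (trans (sym e′) (trans e et))
      pair : ∀ {y z} → S v y → S v z → y ≢ top → z ≢ top → parent y ≡ x → parent z ≡ x → y ≡ z
      pair y∈ z∈ y≢t z≢t py pz = one y∈ z∈ y≢t z≢t (trans py (sym pz)) (λ e → t≢x (trans (sym e) py))
      with-x : ∀ {y z} → S v x → w ≡ top → S v y → S v z → y ≢ top → z ≢ top → y ≢ x → z ≢ x →
               parent y ≡ top → parent z ≡ top → y ≡ z
      with-x x∈ w≡t y∈ z∈ y≢t z≢t y≢x z≢x py pz with two x∈ y∈ z∈ (≢-sym t≢x) y≢t z≢t w≡t py pz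
      ... | inj₁ e = ⊥-elim (y≢x (sym e))
      ... | inj₂ (inj₁ e) = ⊥-elim (z≢x (sym e))
      ... | inj₂ (inj₂ e) = e
      triple : Kind a → Kind b → Kind c → a ≡ b ⊎ a ≡ c ⊎ b ≡ c
      triple (inj₁ (p , _)) (inj₁ (q , _)) _ = inj₁ (pair a∈ b∈ a≢t b≢t p q)
      triple (inj₁ (p , _)) (inj₂ _) (inj₁ (q , _)) = inj₂ (inj₁ (pair a∈ c∈ a≢t c≢t p q))
      triple (inj₂ _) (inj₁ (p , _)) (inj₁ (q , _)) = inj₂ (inj₂ (pair b∈ c∈ b≢t c≢t p q))
      triple (inj₁ (_ , x∈ , wt)) (inj₂ p) (inj₂ q) = inj₂ (inj₂ (with-x x∈ wt b∈ c∈ b≢t c≢t b≢x c≢x p q))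
      triple (inj₂ p) (inj₁ (_ , x∈ , wt)) (inj₂ q) = inj₂ (inj₁ (with-x x∈ wt a∈ c∈ a≢t c≢t a≢x c≢x p q))
      triple (inj₂ p) (inj₂ q) (inj₁ (_ , x∈ , wt)) = inj₁ (with-x x∈ wt a∈ b∈ a≢t b≢t a≢x b≢x p q)
      triple (inj₂ p) (inj₂ q) (inj₂ r) = two a∈ b∈ c∈ a≢t b≢t c≢t p q r

    merged-path : PathSet contracted-tree Merged
    merged-path = record { top = top′ ; top∈ = top′∈ ; up = up′ ; one = one′ ; two = two′ }

  Nested : Set
  Nested = (∀ u → S u x → S u w) ⊎ (∀ u → S u w → S u x)

  -- The paths at the merged vertex are those of the larger of the two nested sets, so no disjoint
  -- pair is made to meet.
  contract : Nested → Representation G A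
  contract nested = record
    { tree = contracted-tree ; S = Merged ; S? = Merged? ; paths = merged-path
    ; meet = λ u v u≢v → let open Equivalence (meet u v u≢v) in mk⇔
        (λ e → let y , yu , yv = to e in forth u v y yu yv) (from ∘ back u v) }
    where
    forth : ∀ u v y → S u y → S v y → ∃ λ z → Merged u z × Merged v z
    forth u v y yu yv with y ≟ x
    ... | yes refl = w , inj₁ (refl , inj₁ yu) , inj₁ (refl , inj₁ yv)
    ... | no y≢x = y , merge u yu y≢x , merge v yv y≢x
    common : Nested → ∀ u v → S u x ⊎ S u w → S v x ⊎ S v w → ∃ λ z → S u z × S v z
    common (inj₁ sub) u v su sv = w , either u su , either v sv
      where
      either : ∀ u → S u x ⊎ S u w → S u w
      either u (inj₁ s) = sub u s
      either u (inj₂ s) = s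
    common (inj₂ sub) u v su sv = x , either u su , either v sv
      where
      either : ∀ u → S u x ⊎ S u w → S u x
      either u (inj₁ s) = s
      either u (inj₂ s) = sub u s
    back : ∀ u v → (∃ λ z → Merged u z × Merged v z) → ∃ λ z → S u z × S v z
    back u v (_ , inj₁ (refl , su) , inj₁ (_ , sv)) = common nested u v su sv
    back u v (_ , inj₁ (refl , _) , inj₂ (_ , z≢w , _)) = ⊥-elim (z≢w refl)
    back u v (_ , inj₂ (_ , z≢w , _) , inj₁ (refl , _)) = ⊥-elim (z≢w refl)
    back u v (z , inj₂ (_ , _ , zu) , inj₂ (_ , _ , zv)) = z , zu , zv

module _ {G : Graph} {N : ℕ} where

  bags : Representation G (Fin N) → Fin N → Bool
  bags R y = does (any? λ v → Representation.S? R v y)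

  -- Only edges used by some path are restricted: links see no others, and contracting such an edge
  -- is sure to empty a nonempty bag.
  Reduced : Representation G (Fin N) → Set
  Reduced R = let open Representation R in
    ∀ {x} → x ≢ root → (∃ λ v → S v x × S v (parent x)) →
    (∃ λ u → S u x × ¬ S u (parent x)) × (∃ λ u → S u (parent x) × ¬ S u x)

  -- The number of vertices lying on some path decreases: `x` drops out, and `w` was on the path of
  -- `v` before.
  reduce : Representation G (Fin N) → Σ (Representation G (Fin N)) Reduced
  reduce R₀ = go R₀ (<-wellFounded _)
    where
    go : ∀ R → Acc _<_ (count (bags R)) → Σ (Representation G (Fin N)) Reduced
    go R (acc rs) with any? (λ x → ¬? (x ≟ root) ×-dec any? (λ v → S? v x ×-dec S? v (parent x))
                        ×-dec (all? (λ u → S? u x →-dec S? u (parent x)) ⊎-dec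
                               all? (λ u → S? u (parent x) →-dec S? u x)))
      where open Representation R
    ... | yes (x , x≢r , (v , vx , vw) , nested) = go (contract nested) (rs smaller)
      where
      open Representation R
      open Contract R x x≢r
      bag : ∀ y → (∃ λ u → S u y) → bags R y ≡ true
      bag y = dec-true (any? λ u → S? u y)
      unbag : ∀ y → bags (contract nested) y ≡ true → ∃ λ u → Merged u y
      unbag y e = does⁻ (any? λ u → Merged? u y) (subst Bool.T (sym e) _)
      sub : ∀ y → (∃ λ u → Merged u y) → ∃ λ u → S u y
      sub y (_ , inj₁ (refl , _)) = v , vw
      sub y (u , inj₂ (_ , _ , uy)) = u , uy
      gone : ¬ (∃ λ u → Merged u x)
      gone (_ , inj₁ (x≡w , _)) = w≢x (sym x≡w)
      gone (_ , inj₂ (x≢x , _)) = x≢x refl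
      smaller : count (bags (contract nested)) < count (bags R)
      smaller = count-strict (λ y e → bag y (sub y (unbag y e))) x
        (dec-false (any? λ u → Merged? u x) gone) (bag x (v , vx))
    ... | no none = R , reduced
      where
      open Representation R
      differ : ∀ x y → ¬ (∀ u → S u x → S u y) → ∃ λ u → S u x × ¬ S u y
      differ x y ne with any? (λ u → S? u x ×-dec ¬? (S? u y))
      ... | yes found = found
      ... | no nope = ⊥-elim (ne sub)
        where
        sub : ∀ u → S u x → S u y
        sub u ux with S? u y
        ... | yes uy = uy
        ... | no ¬uy = ⊥-elim (nope (u , ux , ¬uy))
      reduced : Reduced R
      reduced {x} x≢r shared =
        differ x (parent x) (λ sub → none (x , x≢r , shared , inj₁ sub)) ,
        differ (parent x) x (λ sub → none (x , x≢r , shared , inj₂ sub))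

-- Colourings and critical graphs

-- Functions are enumerated value by value, so they are matched only pointwise, and `P` has to
-- respect pointwise equality.
any-function? : ∀ {m k} (P : (Fin m → Fin k) → Set) → (∀ {f g} → (∀ x → f x ≡ g x) → P f → P g) →
                (∀ f → Dec (P f)) → Dec (∃ P)
any-function? {zero} P resp P? = map′ (λ p → Vector.[] , p) (λ (_ , p) → resp (λ ()) p) (P? Vector.[])
any-function? {suc m} P resp P? =
  map′ (λ (a , f , p) → (a Vector.∷ f) , p)
       (λ (f , p) → f zero , f ∘ suc , resp (λ { zero → refl ; (suc _) → refl }) p)
       (any? λ a → any-function? (λ f → P (a Vector.∷ f))
         (λ e → resp λ { zero → refl ; (suc x) → e x }) (λ f → P? (a Vector.∷ f)))

colorable? : ∀ G k → Dec (Colorable G k)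
colorable? G k = any-function? (λ c → ∀ x y → E G x y → c x ≢ c y)
  (λ e proper x y xy e′ → proper x y xy (trans (e x) (trans e′ (sym (e y)))))
  (λ c → all? λ x → all? λ y → E? G x y →-dec ¬? (c x Finₚ.≟ c y))

colorable-mono : ∀ G {j k} → j ≤ k → Colorable G j → Colorable G k
colorable-mono G j≤k (c , proper) =
  (λ x → inject≤ (c x) j≤k) , λ x y e eq → proper x y e (Finₚ.inject≤-injective j≤k j≤k _ _ eq)

chromatic-number : ∀ G k → Colorable G k → ∃ λ j → j ≤ k × HasChromaticNumber G j
chromatic-number G zero c = 0 , z≤n , c , λ _ ()
chromatic-number G (suc k) c with colorable? G k
... | yes c′ = let j , j≤k , has = chromatic-number G k c′ in j , ℕₚ.m≤n⇒m≤1+n j≤k , has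
... | no ¬c′ = suc k , ℕₚ.≤-refl , c , λ j j<sk c″ → ¬c′ (colorable-mono G (ℕₚ.≤-pred j<sk) c″)

colorable⇒below : ∀ G {k} → Colorable G k → ChromaticNumberBelow G (suc k)
colorable⇒below G c = let j , j≤k , has = chromatic-number G _ c in j , s≤s j≤k , has

below⇒colorable : ∀ G {k} → ChromaticNumberBelow G (suc k) → Colorable G k
below⇒colorable G (j , j<sk , c , _) = colorable-mono G (ℕₚ.≤-pred j<sk) c

-- `deleteVertex` computes only once the number of vertices is known to be a successor. This
-- interface is proved by that case distinction and then used for arbitrary graphs.
record Deletion (G : Graph) (v : Fin (n G)) : Set where
  field
    embed           : Fin (n (deleteVertex G v)) → Fin (n G)
    embed-injective : ∀ {x y} → embed x ≡ embed y → x ≡ y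
    embed≢          : ∀ x → embed x ≢ v
    cover           : ∀ {x} → x ≢ v → ∃ λ y → embed y ≡ x
    adj-embed       : ∀ x y → adj (deleteVertex G v) x y ≡ adj G (embed x) (embed y)
    size            : suc (n (deleteVertex G v)) ≡ n G

deletion : ∀ G v → Deletion G v
deletion record { n = suc m } v = record
  { embed = punchIn v ; embed-injective = Finₚ.punchIn-injective v _ _
  ; embed≢ = Finₚ.punchInᵢ≢i v
  ; cover = λ ne → punchOut (≢-sym ne) , Finₚ.punchIn-punchOut (≢-sym ne)
  ; adj-embed = λ _ _ → refl ; size = refl }

ProperOff : (G : Graph) → Fin (n G) → ∀ {k} → (Fin (n G) → Fin k) → Set
ProperOff G v c = ∀ x y → x ≢ v → y ≢ v → E G x y → c x ≢ c y

off-colouring : ∀ {G v k} → Colorable (deleteVertex G v) (suc k) → Σ (Fin (n G) → Fin (suc k)) (ProperOff G v)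
off-colouring {G} {v} {k} (c , proper) = col , col-proper
  where
  open Deletion (deletion G v)
  at : ∀ {x} → Dec (x ≡ v) → Fin (suc k)
  -- An arbitrary colour, since `ProperOff` says nothing about `v`.
  at (yes _) = zero
  at (no ne) = c (proj₁ (cover ne))
  col : Fin (n G) → Fin (suc k)
  col x = at (x Finₚ.≟ v)
  col-proper : ProperOff G v col
  col-proper x y x≢ y≢ e with x Finₚ.≟ v | y Finₚ.≟ v
  ... | yes x≡ | _ = ⊥-elim (x≢ x≡)
  ... | no _ | yes y≡ = ⊥-elim (y≢ y≡)
  ... | no x≢v | no y≢v with cover x≢v | cover y≢v
  ...   | x′ , refl | y′ , refl = proper x′ y′ (subst Bool.T (sym (adj-embed x′ y′)) e)

extend-colouring : ∀ {G v k} {c : Fin (n G) → Fin k} (d : Fin k) → ProperOff G v c →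
                   (∀ {x} → E G v x → c x ≢ d) → Colorable G k
extend-colouring {G} {v} {k} {c} d proper avoid = c′ , proper′
  where
  c′ : Fin (n G) → Fin k
  c′ = updateAt c v (const d)
  c′-v : c′ v ≡ d
  c′-v = updateAt-updates v c
  c′-off : ∀ {x} → x ≢ v → c′ x ≡ c x
  c′-off ne = updateAt-minimal _ v c ne
  proper′ : ∀ x y → E G x y → c′ x ≢ c′ y
  proper′ x y e eq with x Finₚ.≟ v | y Finₚ.≟ v
  ... | yes refl | yes refl = E-irrefl G e
  ... | yes refl | no y≢v = avoid e (trans (sym (c′-off y≢v)) (trans (sym eq) c′-v))
  ... | no x≢v | yes refl = avoid (E-sym G e) (trans (sym (c′-off x≢v)) (trans eq c′-v))
  ... | no x≢v | no y≢v = proper x y x≢v y≢v e (trans (sym (c′-off x≢v)) (trans eq (c′-off y≢v)))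

module _ (G : Graph) {u v : Fin (n G)} where

  deleteEdge-⊆ : ∀ {x y} → E (deleteEdge G u v) x y → E G x y
  deleteEdge-⊆ e = proj₁ (Equivalence.to T-∧ e)

  deleteEdge-removes : adj (deleteEdge G u v) u v ≡ false
  deleteEdge-removes with u Finₚ.≟ u | v Finₚ.≟ v
  ... | yes _ | yes _ = ∧-zeroʳ (adj G u v)
  ... | no ne | _     = ⊥-elim (ne refl)
  ... | yes _ | no ne = ⊥-elim (ne refl)

  deleteEdge-keeps : ∀ {x y} → ¬ (x ≡ u × y ≡ v) → ¬ (x ≡ v × y ≡ u) → E G x y → E (deleteEdge G u v) x y
  deleteEdge-keeps {x} {y} ne ne′ e with x Finₚ.≟ u | y Finₚ.≟ v | x Finₚ.≟ v | y Finₚ.≟ u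
  ... | yes p | yes q | _     | _     = ⊥-elim (ne (p , q))
  ... | no _  | _     | yes p | yes q = ⊥-elim (ne′ (p , q))
  ... | yes _ | no _  | yes p | yes q = ⊥-elim (ne′ (p , q))
  ... | yes _ | no _  | no _  | _     = Equivalence.from T-∧ (e , _)
  ... | yes _ | no _  | yes _ | no _  = Equivalence.from T-∧ (e , _)
  ... | no _  | _     | no _  | _     = Equivalence.from T-∧ (e , _)
  ... | no _  | _     | yes _ | no _  = Equivalence.from T-∧ (e , _)

edge-count : Graph → ℕ
edge-count G = count {n G * n G} λ i → let x , y = remQuot {n G} (n G) i in adj G x y

edge-count-< : ∀ G {u v} → E G u v → edge-count (deleteEdge G u v) < edge-count G
edge-count-< G {u} {v} e = count-strict sub (combine u v)
  (trans (pair (deleteEdge G u v)) (deleteEdge-removes G)) (trans (pair G) (T⇒true e))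
  where
  T⇒true : ∀ {b} → Bool.T b → b ≡ true
  T⇒true {true} _ = refl
  pair : ∀ K → {u v : Fin (n K)} → (let x , y = remQuot {n K} (n K) (combine u v) in adj K x y) ≡ adj K u v
  pair K {u} {v} = cong (λ (x , y) → adj K x y) (Finₚ.remQuot-combine {n K} u v)
  sub : ∀ i → _ ≡ true → _ ≡ true
  sub i e′ = T⇒true (deleteEdge-⊆ G {u} {v} (subst Bool.T (sym e′) _))

module Criticality (k : ℕ) where

  Colours : Set
  Colours = Fin (suc k)

  CriticalSubgraph : Graph → Set
  CriticalSubgraph B = Σ Graph λ H → Critical (suc (suc k)) H × Σ (Fin (n H) → Fin (n B)) λ f →
    (∀ {x y} → f x ≡ f y → x ≡ y) × (∀ {x y} → E H x y → E B (f x) (f y))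

  -- Vertices and edges are deleted as long as `suc k` colours do not suffice, by induction on the
  -- number of vertices and, within it, of edges. Where every deletion gives a colourable graph, the
  -- graph is critical.
  critical-subgraph : ∀ B → ¬ Colorable B (suc k) → CriticalSubgraph B
  critical-subgraph B₀ = by-size (n B₀) B₀ refl
    where
    by-edges : ∀ m → (∀ B → n B ≡ m → ¬ Colorable B (suc k) → CriticalSubgraph B) →
               ∀ B → n B ≡ suc m → Acc _<_ (edge-count B) → ¬ Colorable B (suc k) → CriticalSubgraph B
    by-edges m smaller B refl (acc rs) ¬c with any? (λ v → ¬? (colorable? (deleteVertex B v) (suc k)))
    ... | yes (v , ¬cv) =
      let open Deletion (deletion B v)
          H , crit , f , inj , mono = smaller (deleteVertex B v) (ℕₚ.suc-injective size) ¬cv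
      in H , crit , embed ∘ f , inj ∘ embed-injective , λ {x} {y} e → subst Bool.T (adj-embed (f x) (f y)) (mono e)
    ... | no vertices with any? (λ u → any? λ v → E? B u v ×-dec ¬? (colorable? (deleteEdge B u v) (suc k)))
    ...   | yes (u , v , e , ¬ce) =
      let H , crit , f , inj , mono = by-edges m smaller (deleteEdge B u v) refl (rs (edge-count-< B e)) ¬ce
      in H , crit , f , inj , λ e′ → deleteEdge-⊆ B {u} {v} (mono e′)
    ...   | no edges = B , critical , id , id , id
      where
      delete-colorable : ∀ v → Colorable (deleteVertex B v) (suc k)
      delete-colorable v = decidable-stable (colorable? (deleteVertex B v) (suc k)) λ ne → vertices (v , ne)
      critical : Critical (suc (suc k)) B
      critical =
        ( let c , proper = off-colouring {B} {zero} (delete-colorable zero) in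
          -- One colour more is enough: vertex `zero` gets the new colour `fromℕ (suc k)`, the
          -- others keep those of the graph without it.
          extend-colouring {B} {zero} {c = inject₁ ∘ c} (fromℕ (suc k))
            (λ x y x≢ y≢ e eq → proper x y x≢ y≢ e (Finₚ.inject₁-injective eq))
            (λ _ e → Finₚ.fromℕ≢inject₁ (sym e))
        , λ j j< c → ¬c (colorable-mono B (ℕₚ.≤-pred j<) c))
        , (λ v → colorable⇒below (deleteVertex B v) (delete-colorable v))
        , λ u v e → colorable⇒below (deleteEdge B u v) (decidable-stable (colorable? (deleteEdge B u v) (suc k)) λ ne → edges (u , v , e , ne))

    by-size : ∀ m B → n B ≡ m → ¬ Colorable B (suc k) → CriticalSubgraph B
    by-size zero    B refl ¬c = ⊥-elim (¬c ((λ ()) , λ ()))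
    by-size (suc m) B e    ¬c = by-edges m (by-size m) B e (<-wellFounded _) ¬c

  module _ {H : Graph} (crit : Critical (suc (suc k)) H) where

    critical-¬colorable : ¬ Colorable H (suc k)
    critical-¬colorable = proj₂ (proj₁ crit) (suc k) ℕₚ.≤-refl

    critical-off : ∀ v → Σ (Fin (n H) → Colours) (ProperOff H v)
    critical-off v = off-colouring {H} {v} (below⇒colorable (deleteVertex H v) (proj₁ (proj₂ crit) v))

    critical-deleteEdge : ∀ {u v} → E H u v → Colorable (deleteEdge H u v) (suc k)
    critical-deleteEdge {u} {v} e = below⇒colorable (deleteEdge H u v) (proj₂ (proj₂ crit) _ _ e)

    -- Were y not reachable from x, the component of x could take its colours from H - y
    -- and the remaining vertices theirs from H - x.
    critical-connected : Connected H
    critical-connected x y with saturate (E? H) (λ A → ∀ z → A z ≡ true → Reach H x z) extend (insert x (const false)) init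
      where
      extend : ∀ {A : Fin (n H) → Bool} {u v} → (∀ z → A z ≡ true → Reach H x z) → A u ≡ true → A v ≡ false →
               E H u v → ∀ z → insert v A z ≡ true → Reach H x z
      extend {A} {u} {v} reach u∈ _ e z z∈ with insert⁻ A v z∈
      ... | inj₁ refl = reach-trans H (reach u u∈) (step e here)
      ... | inj₂ (_ , z∈A) = reach z z∈A
      init : ∀ z → insert x (const false) z ≡ true → Reach H x z
      init z z∈ with insert⁻ (const false) x z∈
      ... | inj₁ refl = here
    ... | B , reach , ⊆B , closed with B y in By
    ...   | true = reach y By
    ...   | false = ⊥-elim (critical-¬colorable (col , proper))
      where
      x∈ : B x ≡ true
      x∈ = ⊆B x (insert-same (const false) x)
      cx = critical-off x
      cy = critical-off y
      col : Fin (n H) → Colours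
      col z = if B z then proj₁ cy z else proj₁ cx z
      proper : ∀ u v → E H u v → col u ≢ col v
      proper u v e with B u in Bu | B v in Bv
      ... | true | true = proj₂ cy u v (∈∉⇒≢ {A = B} Bu By) (∈∉⇒≢ {A = B} Bv By) e
      ... | false | false = proj₂ cx u v (≢-sym (∈∉⇒≢ {A = B} x∈ Bu)) (≢-sym (∈∉⇒≢ {A = B} x∈ Bv)) e
      ... | true | false with trans (sym (closed Bu e)) Bv
      ...   | ()
      proper u v e | false | true with trans (sym (closed Bv (E-sym H e))) Bu
      ...   | ()

-- Otherwise a colouring of `H` without `x` would extend to `x` by any colour other than that of
-- `y`, and there are at least two colours.
critical-neighbour : ∀ {k H} → Critical (suc (suc (suc k))) H → ∀ x y → ∃ λ z → z ≢ y × E H x z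
critical-neighbour {k} {H} crit x y with any? (λ z → ¬? (z Finₚ.≟ y) ×-dec E? H x z)
... | yes found = found
... | no none = ⊥-elim (critical-¬colorable crit (extend-colouring {H} {x} (proj₁ other) proper avoid))
  where
  open Criticality (suc k)
  c = proj₁ (critical-off crit x)
  proper = proj₂ (critical-off crit x)
  another : ∀ (i : Fin (suc (suc k))) → ∃ λ d → i ≢ d
  another zero    = suc zero , λ ()
  another (suc _) = zero , λ ()
  other = another (c y)
  avoid : ∀ {z} → E H x z → c z ≢ proj₁ other
  avoid {z} e with z Finₚ.≟ y
  ... | yes refl = proj₂ other
  ... | no ne = ⊥-elim (none (z , ne , e))


-- This makes every case about `lvtx` vacuous for critical `H`.
no-leaf : ∀ {k H} → Critical (suc (suc (suc k))) H → ∀ x → degree H x ≢ 1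
no-leaf {k} {H} crit x deg =
  let y , _ , xy = critical-neighbour crit x x
      z , z≢y , xz = critical-neighbour crit x y
  in z≢y (singleton deg (neighbour xz) (neighbour xy))
  where
  neighbour : ∀ {y} → E H x y → y ∈ neighbours H x
  neighbour {y} e = ∈-filter⁺ (T? ∘ adj H x) (∈-allFin y) e
  singleton : ∀ {l : List (Fin (n H))} {y z} → length l ≡ 1 → y ∈ l → z ∈ l → y ≡ z
  singleton {_ ∷ []} _ (here refl) (here refl) = refl

-- Vertices of G_H and induced copies of G_H

-- Vertices `evtx` and `lvtx` carry proofs; as these are unique, a search need only test one.
Σ-dec : {P : Set} {Q : P → Set} → (∀ (p q : P) → p ≡ q) → Dec P → (∀ p → Dec (Q p)) → Dec (Σ P Q)
Σ-dec irr (no ¬p) Q? = no λ (p , _) → ¬p p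
Σ-dec {Q = Q} irr (yes p) Q? = map′ (λ q → p , q) (λ (p′ , q) → subst Q (irr p′ p) q) (Q? p)

module _ {H : Graph} where

  any-vertex? : {P : GHVertex H → Set} → (∀ a → Dec (P a)) → Dec (∃ P)
  any-vertex? {P} P? = map′ join split
    (any? (λ i → P? (vtx i)) ⊎-dec
     any? (λ i → any? λ j → Σ-dec Finₚ.<-irrelevant (i Finₚ.<? j) λ lt →
       Σ-dec T-irrelevant (E? H i j) λ e → P? (evtx i j lt e)) ⊎-dec
     any? (λ i → Σ-dec ℕₚ.≡-irrelevant (degree H i ℕ.≟ 1) λ d → P? (lvtx i d)))
    where
    join : _ → ∃ P
    join (inj₁ (_ , p)) = _ , p
    join (inj₂ (inj₁ (_ , _ , _ , _ , p))) = _ , p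
    join (inj₂ (inj₂ (_ , _ , p))) = _ , p
    split : ∃ P → _
    split (vtx i , p) = inj₁ (i , p)
    split (evtx i j lt e , p) = inj₂ (inj₁ (i , j , lt , e , p))
    split (lvtx i d , p) = inj₂ (inj₂ (i , d , p))

  IsEdge : GHVertex H → Set
  IsEdge (evtx _ _ _ _) = ⊤
  IsEdge _ = ⊥

  IsEdge? : ∀ a → Dec (IsEdge a)
  IsEdge? (vtx _) = no λ ()
  IsEdge? (evtx _ _ _ _) = yes tt
  IsEdge? (lvtx _ _) = no λ ()

  evtx-≡ : ∀ {i j i′ j′ lt lt′ e e′} → i ≡ i′ → j ≡ j′ → evtx {H} i j lt e ≡ evtx i′ j′ lt′ e′
  evtx-≡ {lt = lt} {lt′} {e} {e′} refl refl = cong₂ (evtx _ _) (Finₚ.<-irrelevant lt lt′) (T-irrelevant e e′)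

  edge-vertex : ∀ {i j} → E H i j → GHVertex H
  edge-vertex {i} {j} e with Finₚ.<-cmp i j
  ... | tri< lt _ _ = evtx i j lt e
  ... | tri≈ _ refl _ = ⊥-elim (E-irrefl H e)
  ... | tri> _ _ gt = evtx j i gt (E-sym H e)

  edge-isEdge : ∀ {i j} (e : E H i j) → IsEdge (edge-vertex e)
  edge-isEdge {i} {j} e with Finₚ.<-cmp i j
  ... | tri< lt _ _ = tt
  ... | tri≈ _ refl _ = ⊥-elim (E-irrefl H e)
  ... | tri> _ _ gt = tt

  vtx-edge : ∀ {l i j} (e : E H i j) → GHAdj H (vtx l) (edge-vertex e) ⇔ (l ≡ i ⊎ l ≡ j)
  vtx-edge {l} {i} {j} e with Finₚ.<-cmp i j
  ... | tri< lt _ _ = mk⇔ id id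
  ... | tri≈ _ refl _ = ⊥-elim (E-irrefl H e)
  ... | tri> _ _ gt = mk⇔ swap swap

  vtx≢edge : ∀ {l a} → IsEdge a → vtx l ≢ a
  vtx≢edge () refl

  edges-adjacent : ∀ {a b} → IsEdge a → IsEdge b → a ≢ b → GHAdj H a b
  edges-adjacent {evtx _ _ _ _} {evtx _ _ _ _} _ _ a≢b (e , e′) = a≢b (evtx-≡ e e′)

record Embedding (H G : Graph) : Set where
  field
    emb       : GHVertex H → Fin (n G)
    injective : ∀ {a b} → emb a ≡ emb b → a ≡ b
    adjacent  : ∀ a b → E G (emb a) (emb b) ⇔ GHAdj H a b

-- Tops, the Helly property and the ancestor order

argmax : ∀ {m} {P : Fin m → Set} → (∀ i → Dec (P i)) → (f : Fin m → ℕ) → ∃ P →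
         ∃ λ i → P i × (∀ j → P j → f j ≤ f i)
argmax {zero} P? f (() , _)
argmax {suc m} {P} P? f some with any? (P? ∘ suc) | P? zero
argmax P? f (zero , p) | no _ | no ¬p = ⊥-elim (¬p p)
argmax P? f (suc i , p) | no none | _ = ⊥-elim (none (i , p))
... | no none | yes p = zero , p , λ { zero _ → ℕₚ.≤-refl ; (suc j) pj → ⊥-elim (none (j , pj)) }
... | yes rest | d with argmax (P? ∘ suc) (f ∘ suc) rest
argmax P? f some | yes rest | no ¬p | i , pi , max =
  suc i , pi , λ { zero p → ⊥-elim (¬p p) ; (suc j) pj → max j pj }
argmax P? f some | yes rest | yes p | i , pi , max with ℕₚ.≤-total (f zero) (f (suc i))
... | inj₁ le = suc i , pi , λ { zero _ → le ; (suc j) pj → max j pj }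
... | inj₂ ge = zero , p , λ { zero _ → ℕₚ.≤-refl ; (suc j) pj → ℕₚ.≤-trans (max j pj) ge }

module _ {G : Graph} {A : Set} (R : Representation G A) where
  open Representation R

  -- From a common vertex, climb towards the root: the parent stays common until one of the two tops
  -- is reached.
  meet-top : ∀ {u v x} → let open PathSet in S u x → S v x → S v (top (paths u)) ⊎ S u (top (paths v))
  meet-top {u} {v} xu = PathSet.climb (paths u) (λ x → S v x → _) inj₁ next xu
    where
    next : ∀ {x} → S u x → _ → (S v (parent x) → _) → S v x → _
    next {x} xu _ rec xv with x ≟ PathSet.top (paths v)
    ... | yes refl = inj₂ xu
    ... | no x≢t   = rec (proj₂ (PathSet.up (paths v) xv x≢t))

  -- The top of largest rank lies on every path of the family.
  helly : {F : Fin (n G) → Set} → (∀ v → Dec (F v)) → ∃ F →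
          (∀ u v → F u → F v → ∃ λ x → S u x × S v x) → ∃ λ q → ∀ v → F v → S v q
  helly F? some meets with argmax F? (λ v → rank (PathSet.top (paths v))) some
  ... | v , Fv , max = top v , λ u Fu → let x , xu , xv = meets u v Fu Fv in go u Fu (meet-top xu xv)
    where
    top : Fin (n G) → A
    top u = PathSet.top (paths u)
    go : ∀ u → _ → S v (top u) ⊎ S u (top v) → S u (top v)
    go u Fu (inj₂ t∈) = t∈
    go u Fu (inj₁ t∈) with top u ≟ top v
    ... | yes e = subst (S u) e (PathSet.top∈ (paths u))
    ... | no ne = let nr , p∈ = PathSet.up (paths v) t∈ ne in
      ⊥-elim (ℕₚ.<⇒≱ (rank-parent nr) (ℕₚ.≤-trans (max u Fu) (PathSet.top-min (paths v) p∈)))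

  data Down : A → A → Set where
    stop : ∀ {x} → Down x x
    _◅_  : ∀ {x y z} → Child y x → Down y z → Down x z

  down-trans : ∀ {x y z} → Down x y → Down y z → Down x z
  down-trans stop    d = d
  down-trans (c ◅ e) d = c ◅ down-trans e d

  down-parent : ∀ {x y} → y ≢ root → Down x (parent y) → Down x y
  down-parent y≢r d = down-trans d ((y≢r , refl) ◅ stop)

  down-unsnoc : ∀ {x y} → Down x y → y ≡ x ⊎ Down x (parent y)
  down-unsnoc stop = inj₁ refl
  down-unsnoc (c ◅ d) with down-unsnoc d
  ... | inj₁ refl = inj₂ (subst (Down _) (sym (proj₂ c)) stop)
  ... | inj₂ d′   = inj₂ (c ◅ d′)

  branch : ∀ y → y ≢ root → ∃ λ b → Child b root × Down b y
  branch y = go y (<-wellFounded (rank y))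
    where
    go : ∀ y → Acc _<_ (rank y) → y ≢ root → ∃ λ b → Child b root × Down b y
    go y (acc rs) y≢r with parent y ≟ root
    ... | yes e = y , (y≢r , e) , stop
    ... | no ne = let b , c , d = go (parent y) (rs (rank-parent y≢r)) ne in b , c , down-parent y≢r d

  module _ (v : Fin (n G)) where
    open PathSet (paths v)

    top-down : ∀ {x} → S v x → Down top x
    top-down = climb (Down top) stop λ x∈ x≢t d → down-parent (proj₁ (up x∈ x≢t)) d

    -- Climbing from `x` to the top, the path can leave the descendants of `y` only through `y`.
    down-top : ∀ {x y} → S v x → Down y x → ¬ S v y → Down y top
    down-top {y = y} x∈ d y∉ = climb (λ x → Down y x → Down y top) id next x∈ d
      where
      next : ∀ {x} → S v x → x ≢ top → (Down y (parent x) → Down y top) → Down y x → Down y top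
      next x∈ _ rec d with down-unsnoc d
      ... | inj₁ refl = ⊥-elim (y∉ x∈)
      ... | inj₂ d′   = rec d′

    module _ (root∈ : S v root) where

      child≢top′ : ∀ {c} → c ≢ root → c ≢ top
      child≢top′ c≢r c≡t with root ≟ top
      ... | yes r≡t = c≢r (trans c≡t (sym r≡t))
      ... | no r≢t = proj₁ (up root∈ r≢t) refl

      upward : ∀ {x y} → Down x y → S v y → S v x
      upward stop y∈ = y∈
      upward ((c≢r , refl) ◅ d) y∈ = proj₂ (up (upward d y∈) (child≢top′ c≢r))

      -- A path through the root has the root as its top, so below the child `b` of the root it
      -- cannot fork.
      comparable : ∀ {b y z} → b ≢ root → Down b y → Down b z → S v y → S v z → Down y z ⊎ Down z y
      comparable _ stop d _ _ = inj₁ d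
      comparable _ (c ◅ d) stop _ _ = inj₂ (c ◅ d)
      comparable b≢r ((c≢r , refl) ◅ d) ((c′≢r , e) ◅ d′) y∈ z∈
        with one (upward d y∈) (upward d′ z∈) (child≢top′ c≢r) (child≢top′ c′≢r) (sym e) (child≢top′ b≢r)
      ... | refl = comparable c≢r d d′ y∈ z∈

-- G_H is outside the class, its vertex-deleted subgraphs inside

graph-inhabited : ∀ G {k} → ¬ Colorable G k → Fin (n G)
graph-inhabited record { n = zero } ¬c = ⊥-elim (¬c ((λ ()) , λ ()))
graph-inhabited record { n = suc _ } _ = zero

module _ {k : ℕ} {H : Graph} (crit : Critical (suc (suc (suc k))) H) where
  open Criticality (suc k)

  -- Rooting the host tree at a vertex common to the paths of all v_ij, the colour of v_i is
  -- the branch of the root containing its path.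
  gh-not-in : ∀ {G} → Embedding H G → ¬ In[ suc (suc k) ,2,1] G
  gh-not-in {G} EM (R , deg) = critical-¬colorable crit (colour , proper)
    where
    open Embedding EM

    common : ∀ {A} (P : Representation G A) → let open Representation P in
             ∀ {a b} → a ≢ b → GHAdj H a b → ∃ λ x → S (emb a) x × S (emb b) x
    common P {a} {b} a≢b ab =
      Equivalence.to (Representation.meet P _ _ (a≢b ∘ injective)) (Equivalence.from (adjacent a b) ab)

    disjoint : ∀ {A} (P : Representation G A) → let open Representation P in
               ∀ {a b x} → a ≢ b → S (emb a) x → S (emb b) x → GHAdj H a b
    disjoint P {a} {b} {x} a≢b xa xb =
      Equivalence.to (adjacent a b) (Equivalence.from (Representation.meet P _ _ (a≢b ∘ injective)) (x , xa , xb))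

    v₀ : Fin (n H)
    v₀ = graph-inhabited H (critical-¬colorable crit)

    e₀ : ∃ λ j → j ≢ v₀ × E H v₀ j
    e₀ = critical-neighbour crit v₀ v₀

    some-host : Fin (n (host R))
    some-host = first (path R (emb (vtx v₀))) (pathIsPath R (emb (vtx v₀)))
      where
      first : ∀ l → IsPath (host R) l → Fin (n (host R))
      first [] (ne , _) = ⊥-elim (ne refl)
      first (x ∷ _) _ = x

    -- Found in a rooting at an arbitrary host vertex, but stated for `path R`, so that the host can
    -- be rooted again at `q`.
    centre : ∃ λ q → ∀ a → IsEdge a → q ∈ path R (emb a)
    centre =
      let P , _ , _ , S≡ = fromVPT R some-host
          open Representation P
          F : Fin (n G) → Set
          F v = ∃ λ a → IsEdge a × emb a ≡ v
          q , all∋q = helly P {F} (λ v → any-vertex? λ a → IsEdge? a ×-dec (emb a Finₚ.≟ v))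
            (emb (edge-vertex (proj₂ (proj₂ e₀))) , _ , edge-isEdge (proj₂ (proj₂ e₀)) , refl)
            (λ { _ _ (a , a-edge , refl) (b , b-edge , refl) → meets P a b a-edge b-edge })
      in q , λ a a-edge → subst (λ X → X q) (S≡ (emb a)) (all∋q (emb a) (a , a-edge , refl))
      where
      meets : ∀ {A} (P : Representation G A) → let open Representation P in
              ∀ a b → IsEdge a → IsEdge b → ∃ λ x → S (emb a) x × S (emb b) x
      meets P a b a-edge b-edge with emb a Finₚ.≟ emb b
      ... | yes e = let open PathSet (Representation.paths P (emb a)) in
                    top , top∈ , subst (λ v → Representation.S P v top) e top∈
      ... | no ne = common P (ne ∘ cong emb) (edges-adjacent a-edge b-edge (ne ∘ cong emb))

    q : Fin (n (host R))
    q = proj₁ centre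

    rooted = fromVPT R q
    P = proj₁ rooted
    open Representation P

    root≡q : root ≡ q
    root≡q = proj₁ (proj₂ rooted)

    root∈ : ∀ {a} → IsEdge a → S (emb a) root
    root∈ {a} a-edge = subst (λ X → X root) (sym (proj₂ (proj₂ (proj₂ rooted)) (emb a)))
      (subst (_∈ path R (emb a)) (sym root≡q) (proj₂ centre a a-edge))

    module Vtx (i : Fin (n H)) = PathSet (paths (emb (vtx i)))

    -- Some edge `jl` of `H` avoids `i`. The path of its vertex contains the root, and v_i is not
    -- adjacent to it.
    root∉ : ∀ i → ¬ S (emb (vtx i)) root
    root∉ i r∈ =
      let j , j≢i , _ = critical-neighbour crit i i
          l , l≢i , jl = critical-neighbour crit j i
      in avoid (≢-sym j≢i) (≢-sym l≢i) (Equivalence.to (vtx-edge jl)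
           (disjoint P (vtx≢edge (edge-isEdge jl)) r∈ (root∈ (edge-isEdge jl))))
      where
      avoid : ∀ {j l : Fin (n H)} → i ≢ j → i ≢ l → ¬ (i ≡ j ⊎ i ≡ l)
      avoid ne _ (inj₁ e) = ne e
      avoid _ ne (inj₂ e) = ne e

    top≢root : ∀ i → Vtx.top i ≢ root
    top≢root i e = root∉ i (subst (S _) e (Vtx.top∈ i))

    arm : ∀ i → ∃ λ b → Child b root × Down P b (Vtx.top i)
    arm i = branch P (Vtx.top i) (top≢root i)

    arm-down : ∀ i {x} → S (emb (vtx i)) x → Down P (proj₁ (arm i)) x
    arm-down i x∈ = down-trans P (proj₂ (proj₂ (arm i))) (top-down P _ x∈)

    -- If the path of v_i separates that of v_j from the root, then every edge at j is an
    -- edge at i.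
    not-shadowed : ∀ {i j y z} → E H i j → S (emb (vtx i)) y → S (emb (vtx j)) z → ¬ Down P y z
    not-shadowed {i} {j} {y} {z} ij y∈ z∈ d = avoid (Equivalence.to (vtx-edge jl)
        (disjoint P (vtx≢edge (edge-isEdge jl)) y∈ (upward P _ (root∈ (edge-isEdge jl)) y↓x xe)))
      where
      vtx≢ : vtx {H} i ≢ vtx j
      vtx≢ refl = E-irrefl H ij
      other = critical-neighbour crit j i
      l = proj₁ other
      jl : E H j l
      jl = proj₂ (proj₂ other)
      point = common P (vtx≢edge (edge-isEdge jl)) (Equivalence.from (vtx-edge jl) (inj₁ refl))
      xe = proj₂ (proj₂ point)
      y↓x : Down P y (proj₁ point)
      y↓x = down-trans P (down-top P _ z∈ d (λ y∈j → disjoint P vtx≢ y∈ y∈j)) (top-down P _ (proj₁ (proj₂ point)))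
      avoid : ¬ (i ≡ j ⊎ i ≡ l)
      avoid (inj₁ e) = vtx≢ (cong vtx e)
      avoid (inj₂ e) = proj₁ (proj₂ other) (sym e)

    -- The path of v_ij contains the root and meets both others. If these lay in one branch, the two
    -- meeting points would be comparable, and one path would shadow the other.
    arm-differ : ∀ {i j} → E H i j → proj₁ (arm i) ≢ proj₁ (arm j)
    arm-differ {i} {j} ij eq =
      let y , yi , ye = on-edge i (inj₁ refl)
          z , zj , ze = on-edge j (inj₂ refl)
      in either yi zj (comparable P _ (root∈ ij-edge) (proj₁ (proj₁ (proj₂ (arm i)))) (arm-down i yi)
              (subst (λ b → Down P b z) (sym eq) (arm-down j zj)) ye ze)
      where
      ij-edge : IsEdge (edge-vertex {H} {i} {j} ij)
      ij-edge = edge-isEdge ij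
      on-edge : ∀ l → l ≡ i ⊎ l ≡ j → ∃ λ x → S (emb (vtx l)) x × S (emb (edge-vertex {H} {i} {j} ij)) x
      on-edge l end = common P (vtx≢edge ij-edge) (Equivalence.from (vtx-edge ij) end)
      either : ∀ {y z} → S (emb (vtx i)) y → S (emb (vtx j)) z → ¬ (Down P y z ⊎ Down P z y)
      either yi zj (inj₁ d) = not-shadowed ij yi zj d
      either yi zj (inj₂ d) = not-shadowed (E-sym H ij) zj yi d

    arm-neighbour : ∀ i → proj₁ (arm i) ∈ neighbours (host R) q
    arm-neighbour i = ∈-filter⁺ (T? ∘ adj (host R) q) (∈-allFin _)
      (E-sym (host R) (subst (E (host R) b) (trans e root≡q) (proj₁ (proj₂ (proj₂ rooted)) (λ b≡q → b≢r (trans b≡q (sym root≡q))))))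
      where
      b = proj₁ (arm i)
      b≢r = proj₁ (proj₁ (proj₂ (arm i)))
      e = proj₂ (proj₁ (proj₂ (arm i)))

    -- The degree of `q` is the length of its list of neighbours, so the position of the arm in that
    -- list is a colour.
    colour : Fin (n H) → Fin (suc (suc k))
    colour i = inject≤ (index (arm-neighbour i)) (deg q)

    proper : ∀ i j → E H i j → colour i ≢ colour j
    proper i j e eq = arm-differ e
      (trans (lookup-index (arm-neighbour i))
        (trans (cong (lookup (neighbours (host R) q)) (Finₚ.inject≤-injective (deg q) (deg q) _ _ eq))
          (sym (lookup-index (arm-neighbour j)))))

-- Subgraphs of G_H have a representation in a star: v_i is the i-th leaf, and v_ij joins the
-- leaves i and j, of which those outside Keep (their v_i being absent) are dropped.
module Star {H G : Graph} (kind : Fin (n G) → GHVertex H)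
  (kind-injective : ∀ {u v} → kind u ≡ kind v → u ≡ v)
  (kind-adjacent : ∀ u v → E G u v ⇔ GHAdj H (kind u) (kind v))
  (leafless : ∀ i → degree H i ≢ 1)
  (Keep : Fin (n H) → Set) (Keep? : ∀ i → Dec (Keep i))
  (kept : ∀ {u i} → kind u ≡ vtx i → Keep i)
  {h : ℕ} (c : Fin (n H) → Fin (suc h))
  (proper : ∀ {u i j lt e} → kind u ≡ evtx i j lt e → Keep i → Keep j → c i ≢ c j) where

  star : RootedTree (Fin (suc (n H)))
  star = record
    { _≟_ = Finₚ._≟_ ; root = zero ; parent = const zero
    ; rank = λ { zero → 0 ; (suc _) → 1 }
    ; parent-root = refl
    ; rank-parent = λ { {zero} ne → ⊥-elim (ne refl) ; {suc _} _ → s≤s z≤n } }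
  open RootedTree star

  Arm : GHVertex H → Fin (suc (n H)) → Set
  Arm (vtx i) x = x ≡ suc i
  Arm (evtx i j _ _) x = x ≡ zero ⊎ ∃ λ l → x ≡ suc l × (l ≡ i ⊎ l ≡ j) × Keep l
  Arm (lvtx _ _) x = x ≡ zero

  Arm? : ∀ a x → Dec (Arm a x)
  Arm? (vtx i) x = x ≟ suc i
  Arm? (evtx i j _ _) x = (x ≟ zero) ⊎-dec
    any? (λ l → (x ≟ suc l) ×-dec ((l Finₚ.≟ i) ⊎-dec (l Finₚ.≟ j)) ×-dec Keep? l)
  Arm? (lvtx _ _) x = x ≟ zero

  singleton-path : ∀ x → PathSet star (_≡ x)
  singleton-path x = record
    { top = x ; top∈ = refl
    ; up = λ e ne → ⊥-elim (ne e)
    ; one = λ e _ ne → ⊥-elim (ne e)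
    ; two = λ e _ _ ne → ⊥-elim (ne e) }

  arm-path : ∀ a → PathSet star (Arm a)
  arm-path (vtx i) = singleton-path (suc i)
  arm-path (lvtx _ _) = singleton-path zero
  arm-path (evtx i j _ _) = record
    { top = zero ; top∈ = inj₁ refl
    ; up = λ _ ne → ne , inj₁ refl
    ; one = λ _ _ _ _ _ ne → ⊥-elim (ne refl)
    ; two = two′ }
    where
    two′ : ∀ {x y z} → _ → _ → _ → x ≢ zero → y ≢ zero → z ≢ zero →
           _ → _ → _ → x ≡ y ⊎ x ≡ z ⊎ y ≡ z
    two′ (inj₁ e) _ _ ne _ _ _ _ _ = ⊥-elim (ne e)
    two′ (inj₂ _) (inj₁ e) _ _ ne _ _ _ _ = ⊥-elim (ne e)
    two′ (inj₂ _) (inj₂ _) (inj₁ e) _ _ ne _ _ _ = ⊥-elim (ne e)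
    two′ (inj₂ (_ , refl , inj₁ refl , _)) (inj₂ (_ , refl , inj₁ refl , _)) (inj₂ _) _ _ _ _ _ _ = inj₁ refl
    two′ (inj₂ (_ , refl , inj₂ refl , _)) (inj₂ (_ , refl , inj₂ refl , _)) (inj₂ _) _ _ _ _ _ _ = inj₁ refl
    two′ (inj₂ (_ , refl , inj₁ refl , _)) (inj₂ _) (inj₂ (_ , refl , inj₁ refl , _)) _ _ _ _ _ _ = inj₂ (inj₁ refl)
    two′ (inj₂ (_ , refl , inj₂ refl , _)) (inj₂ _) (inj₂ (_ , refl , inj₂ refl , _)) _ _ _ _ _ _ = inj₂ (inj₁ refl)
    two′ (inj₂ _) (inj₂ (_ , refl , inj₁ refl , _)) (inj₂ (_ , refl , inj₁ refl , _)) _ _ _ _ _ _ = inj₂ (inj₂ refl)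
    two′ (inj₂ _) (inj₂ (_ , refl , inj₂ refl , _)) (inj₂ (_ , refl , inj₂ refl , _)) _ _ _ _ _ _ = inj₂ (inj₂ refl)

  meet-arms : ∀ a b → a ≢ b → (∀ {i} → a ≡ vtx i → Keep i) → (∀ {i} → b ≡ vtx i → Keep i) →
              GHAdj H a b ⇔ (∃ λ x → Arm a x × Arm b x)
  meet-arms (lvtx i d) _ _ _ _ = ⊥-elim (leafless i d)
  meet-arms _ (lvtx i d) _ _ _ = ⊥-elim (leafless i d)
  meet-arms (vtx i) (vtx j) ne _ _ = mk⇔ (λ ()) λ { (_ , refl , refl) → ne refl }
  meet-arms (vtx i) (evtx _ _ _ _) _ ka _ =
    mk⇔ (λ end → suc i , refl , inj₂ (i , refl , end , ka refl))
        (λ { (_ , refl , inj₂ (_ , refl , end , _)) → end })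
  meet-arms (evtx _ _ _ _) (vtx i) _ _ kb =
    mk⇔ (λ end → suc i , inj₂ (i , refl , end , kb refl) , refl)
        (λ { (_ , inj₂ (_ , refl , end , _) , refl) → end })
  meet-arms (evtx _ _ _ _) (evtx _ _ _ _) ne _ _ =
    mk⇔ (λ _ → zero , inj₁ refl , inj₁ refl) (λ _ (e , e′) → ne (evtx-≡ e e′))

  representation : Representation G (Fin (suc (n H)))
  representation = record
    { tree = star ; S = Arm ∘ kind ; S? = Arm? ∘ kind ; paths = arm-path ∘ kind
    ; meet = λ u v u≢v →
        let module A = Equivalence (kind-adjacent u v)
            module M = Equivalence (meet-arms (kind u) (kind v) (u≢v ∘ kind-injective) kept kept)
        in mk⇔ (M.to ∘ A.to) (A.from ∘ M.from) }

  -- Only turns at the centre `zero` matter, because a leaf has a single neighbour; the other values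
  -- are defaults.
  colour : Fin (suc (n H)) → Fin (suc (n H)) → Fin (suc h)
  colour zero    (suc i) = c i
  colour zero    zero    = zero
  colour (suc _) _       = zero

  leaf-neighbour : ∀ {i y} → Adj (suc i) y → y ≡ zero
  leaf-neighbour (inj₁ (_ , e)) = sym e
  leaf-neighbour (inj₂ (_ , ()))

  arms-differ : ∀ u a → kind u ≡ a → ∀ {i j} → Arm a zero → Arm a (suc i) → Arm a (suc j) → i ≢ j → c i ≢ c j
  arms-differ u (evtx _ _ _ _) eq _ (inj₂ (_ , refl , inj₁ refl , ki)) (inj₂ (_ , refl , inj₂ refl , kj)) _ = proper eq ki kj
  arms-differ u (evtx _ _ _ _) eq _ (inj₂ (_ , refl , inj₂ refl , ki)) (inj₂ (_ , refl , inj₁ refl , kj)) _ = ≢-sym (proper eq kj ki)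
  arms-differ u (evtx _ _ _ _) eq _ (inj₂ (_ , refl , inj₁ refl , _)) (inj₂ (_ , refl , inj₁ refl , _)) ne = ⊥-elim (ne refl)
  arms-differ u (evtx _ _ _ _) eq _ (inj₂ (_ , refl , inj₂ refl , _)) (inj₂ (_ , refl , inj₂ refl , _)) ne = ⊥-elim (ne refl)

  colour-proper : ∀ u {q y z} → Arm (kind u) q → Arm (kind u) y → Arm (kind u) z →
                  Adj q y → Adj q z → y ≢ z → colour q y ≢ colour q z
  colour-proper u {suc _} _ _ _ qy qz ne = ⊥-elim (ne (trans (leaf-neighbour qy) (sym (leaf-neighbour qz))))
  colour-proper u {zero} {zero} _ _ _ qy _ _ = ⊥-elim (Adj-irrefl qy)
  colour-proper u {zero} {suc _} {zero} _ _ _ _ qz _ = ⊥-elim (Adj-irrefl qz)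
  colour-proper u {zero} {suc _} {suc _} q∈ y∈ z∈ _ _ ne = arms-differ u (kind u) refl q∈ y∈ z∈ (ne ∘ cong suc)

  star-in : 3 ≤ suc h → In[ suc h ,2,1] G
  star-in = Split.bounded representation colour colour-proper

module _ {k : ℕ} {H : Graph} (crit : Critical (suc (suc (suc k))) H) {G : Graph} (iso : IsoToGH G H) where
  open Criticality (suc k)
  open Inverse (proj₁ iso)

  iso-embedding : Embedding H G
  iso-embedding = record
    { emb = from
    ; injective = λ {a} {b} e → trans (sym (strictlyInverseˡ a)) (trans (cong to e) (strictlyInverseˡ b))
    ; adjacent = λ a b → subst₂ (λ a′ b′ → E G (from a) (from b) ⇔ GHAdj H a′ b′)
        (strictlyInverseˡ a) (strictlyInverseˡ b) (proj₂ iso (from a) (from b)) }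

  delete-in : 3 ≤ suc (suc k) → ∀ v → In[ suc (suc k) ,2,1] (deleteVertex G v)
  delete-in 3≤h v = by-kind (to v) refl
    where
    open Deletion (deletion G v)
    kind : Fin (n (deleteVertex G v)) → GHVertex H
    kind = to ∘ embed
    to-injective : ∀ {x y} → to x ≡ to y → x ≡ y
    to-injective e = trans (sym (strictlyInverseʳ _)) (trans (cong from e) (strictlyInverseʳ _))
    kind-adjacent : ∀ u w → E (deleteVertex G v) u w ⇔ GHAdj H (kind u) (kind w)
    kind-adjacent u w = subst (λ b → Bool.T b ⇔ GHAdj H (kind u) (kind w)) (sym (adj-embed u w))
      (proj₂ iso (embed u) (embed w))
    kind≢ : ∀ {u} → kind u ≢ to v
    kind≢ {u} e = embed≢ u (to-injective e)
    by-kind : ∀ a → to v ≡ a → In[ suc (suc k) ,2,1] (deleteVertex G v)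
    by-kind (lvtx i d) _ = ⊥-elim (no-leaf crit i d)
    -- The vertices v_ij with an end `i₀` remain but lose their arm to that leaf, so a colouring
    -- that is proper away from `i₀` is enough.
    by-kind (vtx i₀) eq =
      let c , off = critical-off crit i₀ in
      Star.star-in kind (embed-injective ∘ to-injective) kind-adjacent (no-leaf crit)
        (_≢ i₀) (λ i → ¬? (i Finₚ.≟ i₀))
        (λ {u} e → λ { refl → kind≢ {u} (trans e (sym eq)) })
        c (λ { {e = e} _ i≢ j≢ → off _ _ i≢ j≢ e }) 3≤h
    -- All leaves are kept. The deleted vertex is the only one of its edge, since the reversed pair
    -- violates the order of the indices.
    by-kind (evtx i₀ j₀ lt₀ e₀) eq =
      let c , proper = critical-deleteEdge crit e₀ in
      Star.star-in kind (embed-injective ∘ to-injective) kind-adjacent (no-leaf crit)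
        (λ _ → ⊤) (λ _ → yes tt) (λ _ → tt)
        c (λ { {u} {i} {j} {lt} {e} eq′ _ _ → proper i j (deleteEdge-keeps H
          (λ { (p , q) → kind≢ {u} (trans eq′ (trans (evtx-≡ p q) (sym eq))) })
          (λ { (refl , refl) → Finₚ.<-asym lt lt₀ }) e) }) 3≤h

-- Links and the induced copy of G_H

module _ {A : Set} {T : RootedTree A} {S : A → Set} (P : PathSet T S) where
  open RootedTree T
  open PathSet P

  -- Of two distinct neighbours of `q`, at least one is a child of `q` other than the top, and its
  -- parent is on the path.
  between : ∀ {q a b} → S a → S b → Adj q a → Adj q b → a ≢ b → S q
  between a∈ b∈ (inj₁ (_ , refl)) (inj₁ (_ , refl)) ne = ⊥-elim (ne refl)
  between {q} a∈ b∈ (inj₁ c@(_ , refl)) (inj₂ d@(_ , refl)) _ =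
    proj₂ (up b∈ (below≢top a∈ (ℕₚ.<-trans (child-< c) (child-< d))))
  between {q} a∈ b∈ (inj₂ d@(_ , refl)) (inj₁ c@(_ , refl)) _ =
    proj₂ (up a∈ (below≢top b∈ (ℕₚ.<-trans (child-< c) (child-< d))))
  between {q} {a} {b} a∈ b∈ (inj₂ (_ , refl)) (inj₂ (_ , e)) ne with a ≟ top | b ≟ top
  ... | no a≢t | _ = proj₂ (up a∈ a≢t)
  ... | yes _ | no b≢t = subst S e (proj₂ (up b∈ b≢t))
  ... | yes refl | yes refl = ⊥-elim (ne refl)

  first-child : ∀ {q a} → S a → ¬ S q → Child a q → a ≡ top
  first-child {a = a} a∈ q∉ (_ , refl) with a ≟ top
  ... | yes e = e
  ... | no ne = ⊥-elim (q∉ (proj₂ (up a∈ ne)))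

module _ {G : Graph} {A : Set} (R : Representation G A) where
  open Representation R

  private
    top : Fin (n G) → A
    top u = PathSet.top (paths u)

  -- The path of `u` lies in the component at `a` of the tree without `q`, and a path from `q` can
  -- enter that component only through `a`.
  into-branch : ∀ {u v q a x} → S u a → ¬ S u q → Adj q a → S v q → S u x → S v x → S v a
  into-branch {u} {v} {q} {a} ua u∌q (inj₂ c) vq ux vx with first-child (paths u) ua u∌q c | meet-top R {u} {v} ux vx
  ... | refl | inj₁ va = va
  ... | refl | inj₂ ut = ⊥-elim (ℕₚ.<⇒≱ (child-< c)
    (ℕₚ.≤-trans (PathSet.top-min (paths u) ut) (PathSet.top-min (paths v) vq)))
  into-branch {u} {v} {q} {a} ua u∌q (inj₁ c@(_ , refl)) vq ux vx with q ≟ top v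
  ... | no q≢t = proj₂ (PathSet.up (paths v) vq q≢t)
  ... | yes refl with meet-top R {u} {v} ux vx
  ...   | inj₁ vt = ⊥-elim (ℕₚ.<⇒≱ (child-< c)
    (ℕₚ.≤-trans (PathSet.top-min (paths v) vt) (PathSet.top-min (paths u) ua)))
  ...   | inj₂ uq = ⊥-elim (u∌q uq)

  below-above : ∀ {u v q a b x} → S u a → ¬ S u q → S v b → ¬ S v q → Child a q → Child q b → S u x → ¬ S v x
  below-above {u} {v} ua u∌q vb v∌q c d ux vx
    with first-child (paths u) ua u∌q c | meet-top R {u} {v} ux vx
  ... | refl | inj₁ va = ℕₚ.<⇒≱ (ℕₚ.<-trans (child-< d) (child-< c))
          (subst (λ t → rank t ≤ _) (sym (first-child (paths v) va v∌q c)) (PathSet.top-min (paths v) vb))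
  ... | refl | inj₂ ut = ℕₚ.<⇒≱ (ℕₚ.<-trans (child-< d) (child-< c))
          (ℕₚ.≤-trans (PathSet.top-min (paths u) ut) (PathSet.top-min (paths v) vb))

  -- The two paths lie in different components of the tree without `q`.
  apart : ∀ {u v q a b x} → S u a → ¬ S u q → S v b → ¬ S v q → Adj q a → Adj q b → a ≢ b →
          S u x → ¬ S v x
  apart _ _ _ _ (inj₁ (_ , refl)) (inj₁ (_ , refl)) ne _ _ = ne refl
  apart {u} {v} ua u∌q vb v∌q (inj₂ c) (inj₂ d) ne ux vx
    with first-child (paths u) ua u∌q c | first-child (paths v) vb v∌q d | meet-top R {u} {v} ux vx
  ... | refl | refl | inj₁ va = ne (first-child (paths v) va v∌q c)
  ... | refl | refl | inj₂ ub = ne (sym (first-child (paths u) ub u∌q d))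
  apart {u} {v} ua u∌q vb v∌q (inj₂ c) (inj₁ d) ne ux vx = below-above {u} {v} ua u∌q vb v∌q c d ux vx
  apart {u} {v} ua u∌q vb v∌q (inj₁ c) (inj₂ d) ne ux vx = below-above {v} {u} vb v∌q ua u∌q d c vx ux

module Link {G : Graph} {N : ℕ} (R : Representation G (Fin N)) where
  open Representation R

  Linked-at : Fin N → Fin N → Fin N → Set
  Linked-at q y z = y ≢ z × Adj q y × Adj q z × ∃ λ v → S v q × S v y × S v z

  linked-at? : ∀ q y z → Dec (Linked-at q y z)
  linked-at? q y z = ¬? (y ≟ z) ×-dec Adj? q y ×-dec Adj? q z ×-dec any? λ v → S? v q ×-dec S? v y ×-dec S? v z

  linked-sym : ∀ {q y z} → Linked-at q y z → Linked-at q z y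
  linked-sym (ne , qy , qz , v , vq , vy , vz) = ≢-sym ne , qz , qy , v , vq , vz , vy

  -- The vertices are all of `Fin N`, those not adjacent to `q` being isolated. A critical subgraph
  -- avoids them, as each of its vertices has an edge.
  link : Fin N → Graph
  link q = record
    { n = N
    ; adj = λ y z → does (linked-at? q y z)
    ; sym = λ y z → does-⇔ (mk⇔ linked-sym linked-sym) (linked-at? q y z) (linked-at? q z y)
    ; irrefl = λ y → dec-false (linked-at? q y y) λ (ne , _) → ne refl }

  links-colourable⇒in : ∀ {h} → 3 ≤ h → (∀ q → Colorable (link q) h) → In[ h ,2,1] G
  links-colourable⇒in 3≤h c = Split.bounded R (λ q → proj₁ (c q))
    (λ v {q} {y} {z} vq vy vz qy qz ne →
      proj₂ (c q) y z (does⁺ (linked-at? q y z) (ne , qy , qz , v , vq , vy , vz))) 3≤h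

  module _ (reduced : Reduced R) {k : ℕ} {H : Graph} (crit : Critical (suc (suc (suc k))) H) (q : Fin N)
           (f : Fin (n H) → Fin N) (f-injective : ∀ {i j} → f i ≡ f j → i ≡ j)
           (f-edge : ∀ {i j} → E H i j → E (link q) (f i) (f j)) where

    linked : ∀ {i j} → E H i j → Linked-at q (f i) (f j)
    linked {i} {j} e = does⁻ (linked-at? q (f i) (f j)) (f-edge e)

    neighbour : ∀ i → Linked-at q (f i) (f (proj₁ (critical-neighbour crit i i)))
    neighbour i = linked (proj₂ (proj₂ (critical-neighbour crit i i)))

    f-adj : ∀ i → Adj q (f i)
    f-adj i = proj₁ (proj₂ (neighbour i))

    -- An edge of `H` at `i` supplies a path using the host edge between `q` and `f i`, so `Reduced`
    -- applies to it, in either orientation.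
    private-path : ∀ i → ∃ λ u → S u (f i) × ¬ S u q
    private-path i = let _ , _ , _ , v , vq , vy , _ = neighbour i in avoiding (f-adj i) v vq vy
      where
      avoiding : ∀ {y} → Adj q y → ∀ v → S v q → S v y → ∃ λ u → S u y × ¬ S u q
      avoiding (inj₁ (q≢r , refl)) v vq vy = proj₂ (reduced q≢r (v , vq , vy))
      avoiding (inj₂ (y≢r , refl)) v vq vy = proj₁ (reduced y≢r (v , vy , vq))

    through : ∀ {i j} → E H i j → ∃ λ v → S v q × S v (f i) × S v (f j)
    through e = proj₂ (proj₂ (proj₂ (linked e)))

    link-embedding : Embedding H G
    link-embedding = record { emb = emb ; injective = λ {a} {b} → injective a b ; adjacent = adjacent }
      where
      emb : GHVertex H → Fin (n G)
      emb (vtx i) = proj₁ (private-path i)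
      emb (evtx i j _ e) = proj₁ (through e)
      emb (lvtx i d) = ⊥-elim (no-leaf crit i d)

      two-ends : ∀ {v i j l} → S v q → S v (f i) → S v (f j) → S v (f l) → i ≢ j → l ≡ i ⊎ l ≡ j
      two-ends {v} {i} {j} {l} vq vi vj vl ne
        with PathSet.no-claw (paths v) vq vi vj vl (f-adj i) (f-adj j) (f-adj l)
      ... | inj₁ e = ⊥-elim (ne (f-injective e))
      ... | inj₂ (inj₁ e) = inj₁ (sym (f-injective e))
      ... | inj₂ (inj₂ e) = inj₂ (sym (f-injective e))

      edge≢ : ∀ {i j} → E H i j → i ≢ j
      edge≢ e refl = E-irrefl H e

      ordered : ∀ {i j l m : Fin (n H)} → i Fin.< j → l Fin.< m → l ≡ i ⊎ l ≡ j → m ≡ i ⊎ m ≡ j → i ≡ l × j ≡ m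
      ordered _   _   (inj₁ refl) (inj₂ refl) = refl , refl
      ordered _   l<m (inj₁ refl) (inj₁ refl) = ⊥-elim (Finₚ.<-irrefl refl l<m)
      ordered _   l<m (inj₂ refl) (inj₂ refl) = ⊥-elim (Finₚ.<-irrefl refl l<m)
      ordered i<j l<m (inj₂ refl) (inj₁ refl) = ⊥-elim (Finₚ.<-asym i<j l<m)

      injective : ∀ a b → emb a ≡ emb b → a ≡ b
      injective (lvtx i d) _ _ = ⊥-elim (no-leaf crit i d)
      injective _ (lvtx i d) _ = ⊥-elim (no-leaf crit i d)
      injective (vtx i) (vtx j) eq with i Finₚ.≟ j
      ... | yes refl = refl
      -- A single path through two neighbours of `q` would contain `q`.
      ... | no i≢j = let u , ui , u∌q = private-path i ; _ , u′j , _ = private-path j in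
        ⊥-elim (u∌q (between (paths u) ui (subst (λ w → S w (f j)) (sym eq) u′j) (f-adj i) (f-adj j) (i≢j ∘ f-injective)))
      injective (vtx i) (evtx j l _ e) eq =
        ⊥-elim (proj₂ (proj₂ (private-path i)) (subst (λ w → S w q) (sym eq) (proj₁ (proj₂ (through e)))))
      injective (evtx j l _ e) (vtx i) eq =
        ⊥-elim (proj₂ (proj₂ (private-path i)) (subst (λ w → S w q) eq (proj₁ (proj₂ (through e)))))
      injective (evtx i j i<j e) (evtx l m l<m e′) eq =
        let _ , vq , vi , vj = through e
            _ , _ , vl , vm = through e′
            back = λ {x} → subst (λ w → S w x) (sym eq)
            i≡l , j≡m = ordered i<j l<m (two-ends vq vi vj (back vl) (edge≢ e)) (two-ends vq vi vj (back vm) (edge≢ e))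
        in evtx-≡ i≡l j≡m

      share : ∀ {a b} x → a ≢ b → S (emb a) x → S (emb b) x → E G (emb a) (emb b)
      share {a} {b} x ne xa xb = Equivalence.from (meet (emb a) (emb b) (ne ∘ injective a b)) (x , xa , xb)

      shared : ∀ {a b} → a ≢ b → E G (emb a) (emb b) → ∃ λ x → S (emb a) x × S (emb b) x
      shared {a} {b} ne = Equivalence.to (meet (emb a) (emb b) (ne ∘ injective a b))

      -- If the paths meet, that of v_jl must pass through `f i`; since it contains `q`, it has room
      -- for only two neighbours of `q`.
      vtx-evtx : ∀ i j l lt e → E G (emb (vtx i)) (emb (evtx j l lt e)) ⇔ (i ≡ j ⊎ i ≡ l)
      vtx-evtx i j l lt e = mk⇔ forth back
        where
        forth : E G (emb (vtx i)) (emb (evtx j l lt e)) → i ≡ j ⊎ i ≡ l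
        forth ad =
          let u , ui , u∌q = private-path i
              v , vq , vj , vl = through e
              x , ux , vx = shared {vtx i} {evtx j l lt e} (λ ()) ad
          in two-ends vq vj vl (into-branch R {u} {v} ui u∌q (f-adj i) vq ux vx) (edge≢ e)
        back : i ≡ j ⊎ i ≡ l → E G (emb (vtx i)) (emb (evtx j l lt e))
        back (inj₁ refl) = share {vtx i} {evtx j l lt e} (f i) (λ ()) (proj₁ (proj₂ (private-path i))) (proj₁ (proj₂ (proj₂ (through e))))
        back (inj₂ refl) = share {vtx i} {evtx j l lt e} (f i) (λ ()) (proj₁ (proj₂ (private-path i))) (proj₂ (proj₂ (proj₂ (through e))))

      adjacent : ∀ a b → E G (emb a) (emb b) ⇔ GHAdj H a b
      adjacent (lvtx i d) _ = ⊥-elim (no-leaf crit i d)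
      adjacent _ (lvtx i d) = ⊥-elim (no-leaf crit i d)
      adjacent (vtx i) (vtx j) = mk⇔ disjoint λ ()
        where
        disjoint : ¬ E G (emb (vtx i)) (emb (vtx j))
        disjoint e with i Finₚ.≟ j
        ... | yes refl = E-irrefl G e
        ... | no i≢j =
          let u , ui , u∌q = private-path i
              v , vj , v∌q = private-path j
              x , ux , vx = shared {vtx i} {vtx j} (λ { refl → i≢j refl }) e
          in apart R {u} {v} ui u∌q vj v∌q (f-adj i) (f-adj j) (i≢j ∘ f-injective) ux vx
      adjacent (vtx i) (evtx j l lt e) = vtx-evtx i j l lt e
      adjacent (evtx j l lt e) (vtx i) =
        let open Equivalence (vtx-evtx i j l lt e) in mk⇔ (to ∘ E-sym G) (E-sym G ∘ from)
      adjacent (evtx i j lt e) (evtx l m lt′ e′) = mk⇔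
        (λ ad (p , p′) → E-irrefl G (subst (λ b → E G (emb (evtx i j lt e)) (emb b)) (sym (evtx-≡ {lt = lt} {lt′} {e} {e′} p p′)) ad))
        (λ ne → share {evtx i j lt e} {evtx l m lt′ e′} q (λ { refl → ne (refl , refl) })
                  (proj₁ (proj₂ (through e))) (proj₁ (proj₂ (through e′))))

-- Minimal graphs are exactly the G_H

module _ {k : ℕ} {H G : Graph} (crit : Critical (suc (suc (suc k))) H) (EM : Embedding H G)
         (minimal : ∀ v → In[ suc (suc k) ,2,1] (deleteVertex G v)) where
  open Embedding EM

  -- A missed vertex could be deleted without harming the copy of G_H, which then would lie in a
  -- graph that minimality places in the class.
  embedding-onto : ∀ v → ∃ λ a → emb a ≡ v
  embedding-onto v = decidable-stable (any-vertex? λ a → emb a Finₚ.≟ v) λ missed →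
    let open Deletion (deletion G v)
        lift : ∀ a → ∃ λ y → embed y ≡ emb a
        lift a = cover (λ e → missed (a , e))
    in gh-not-in crit record
      { emb = proj₁ ∘ lift
      ; injective = λ {a} {b} e → injective {a} {b} (trans (sym (proj₂ (lift a))) (trans (cong embed e) (proj₂ (lift b))))
      ; adjacent = λ a b → subst (λ t → Bool.T t ⇔ GHAdj H a b)
          (trans (cong₂ (adj G) (sym (proj₂ (lift a))) (sym (proj₂ (lift b)))) (sym (adj-embed (proj₁ (lift a)) (proj₁ (lift b)))))
          (adjacent a b) } (minimal v)

  embedding-iso : IsoToGH G H
  embedding-iso = mk↔ₛ′ (proj₁ ∘ embedding-onto) emb (λ a → injective (proj₂ (embedding-onto (emb a)))) (proj₂ ∘ embedding-onto)
    , λ x y → subst₂ (λ x′ y′ → E G x′ y′ ⇔ GHAdj H (proj₁ (embedding-onto x)) (proj₁ (embedding-onto y)))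
        (proj₂ (embedding-onto x)) (proj₂ (embedding-onto y)) (adjacent _ _)

module _ {k : ℕ} (3≤h : 3 ≤ suc (suc k)) {G : Graph} (¬in : ¬ In[ suc (suc k) ,2,1] G) where

  contains-gh : VPTRep G → ∃ λ H → Critical (suc (suc (suc k))) H × Embedding H G
  contains-gh R₀ with reduce (proj₁ (fromVPT R₀ (host-vertex (host R₀) (λ deg → ¬in (R₀ , deg)))))
    where
    host-vertex : ∀ T → ¬ MaxDegreeAtMost (suc (suc k)) T → Fin (n T)
    -- An empty host would satisfy the degree bound vacuously.
    host-vertex record { n = zero } ¬deg = ⊥-elim (¬deg λ ())
    host-vertex record { n = suc _ } _ = zero
  ... | R , reduced with any? (λ q → ¬? (colorable? (Link.link R q) (suc (suc k))))
  ...   | no none = ⊥-elim (¬in (Link.links-colourable⇒in R 3≤h λ q →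
            decidable-stable (colorable? (Link.link R q) (suc (suc k))) λ ¬c → none (q , ¬c)))
  ...   | yes (q , ¬c) =
            let H , crit , f , f-inj , f-edge = Criticality.critical-subgraph (suc k) (Link.link R q) ¬c
            in H , crit , Link.link-embedding R reduced crit q f f-inj f-edge

theorem19 : (h : ℕ) → 3 ≤ h → (G : Graph) → Connected G → VPT G →
    (MinimalNon[ h ,2,1] G ⇔
    Σ Graph (λ H → Connected H × Critical (suc h) H × IsoToGH G H))
theorem19 (suc (suc k)) 3≤h G _ R = mk⇔
  (λ (¬in , minimal) → let H , crit , EM = contains-gh 3≤h ¬in R in
    H , Criticality.critical-connected (suc k) crit , crit , embedding-iso crit EM minimal)
  (λ (H , _ , crit , iso) → gh-not-in crit (iso-embedding crit iso) , delete-in crit iso 3≤h)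
theorem19 (suc zero) (s≤s ())
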